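{- Let $m,k\in\mathbb Z^+$, $a_1,\ldots,a_k\in\mathbb Z$, $n_1,\ldots,n_k\in\mathbb Z^+$. For $n\in\mathbb N$ and real $0\leqslant\alpha<1$ define $$S(n,\alpha)=\sum_{\substack{m_1,\ldots,m_k\in\mathbb Z^+\\ \{\sum_{s=1}^km_s/n_s\}=\alpha}}(-1)^{\lfloor\sum_{s=1}^km_s/n_s\rfloor}\binom{n}{\lfloor\sum_{s=1}^km_s/n_s\rfloor}e^{2\pi i\sum_{s=1}^ka_sm_s/n_s}$$ (a finite sum, since the binomial coefficient vanishes once $\lfloor\sum_s m_s/n_s\rfloor>n$). Then the system $\{a_s(n_s)\}_{s=1}^k$ is an $m$-system (i.e. every $x\in\mathbb Z$ satisfies $|\{1\leqslant s\leqslant k: x\equiv a_s\pmod{n_s}\}|\leqslant m$) if and only if for every integer $n$ with $m\leqslant n<k$ and every $0\leqslant\alpha<1$, $$S(n,\alpha)=\begin{cases}(-1)^k&\text{if }\alpha=0,\\ 0&\text{if }0<\alpha<1.\end{cases}$$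
   Context: $\{x\}$ and $\lfloor x\rfloor$ denote the fractional and integer parts of a real $x$; $\binom{n}{j}=0$ for integers $j>n\geqslant0$. -}

module Defs where

open import Level using (Level; _⊔_)
open import Data.Nat as ℕ using (ℕ; zero; suc; NonZero)
import Data.Nat.Properties as ℕP
open import Data.Nat.Combinatorics using (_C_)
import Data.Nat.Divisibility as ℕD
open import Data.Integer as ℤ using (ℤ; +_; -[1+_])
open import Data.Integer.DivMod using (_%ℕ_)
open import Data.Rational as ℚ using (ℚ; floor)
import Data.Rational.Properties as ℚP
open import Data.Fin using (Fin; zero; suc)
open import Data.List as List using (List; []; _∷_; filter; length; map; concatMap; allFin)
open import Data.Vec.Functional as VF using ()
open import Relation.Nullary using (¬_)
open import Relation.Nullary.Decidable using (Dec; yes; no)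
open import Relation.Binary.PropositionalEquality using (_≡_)
open import Algebra.Bundles using (CommutativeRing)
open import Data.Sum using (_⊎_)

_≡_[mod_] : ℤ → ℤ → ℕ → Set
x ≡ a [mod n ] = (+ n) Data.Integer.Divisibility.∣ (x ℤ.- a)
  where import Data.Integer.Divisibility

congDec : ∀ x a n → Dec (x ≡ a [mod n ])
congDec x a n = ℤ.∣ + n ∣ ℕD.∣? ℤ.∣ x ℤ.- a ∣

coverCount : ∀ {k} → (Fin k → ℤ) → (Fin k → ℕ) → ℤ → ℕ
coverCount {k} a ns x = length (filter (λ s → congDec x (a s) (ns s)) (allFin k))

IsMSystem : ∀ {k} → ℕ → (Fin k → ℤ) → (Fin k → ℕ) → Set
IsMSystem m a ns = ∀ (x : ℤ) → coverCount a ns x ℕ.≤ m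

range1 : ℕ → List ℕ
range1 b = map suc (List.upTo b)

tuples : ∀ k → (Fin k → ℕ) → List (Fin k → ℕ)
tuples zero    b = (λ ()) ∷ []
tuples (suc k) b =
  concatMap (λ x → map (λ t → x VF.∷ t) (tuples k (λ s → b (suc s)))) (range1 (b zero))

sumℚ : ∀ {k} → (Fin k → ℚ) → ℚ
sumℚ {zero}  f = ℚ.0ℚ
sumℚ {suc k} f = f zero ℚ.+ sumℚ (λ s → f (suc s))

wsum : ∀ {k} (ns : Fin k → ℕ) → (∀ s → NonZero (ns s)) →
       (Fin k → ℤ) → (Fin k → ℕ) → ℚ
wsum ns pos c ms = sumℚ (λ s → ℚ._/_ (c s ℤ.* + ms s) (ns s) {{pos s}})

frac : ℚ → ℚ
frac q = q ℚ.- (floor q ℚ./ 1)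

module _ {c ℓ : Level} (R : CommutativeRing c ℓ) where
  open CommutativeRing R

  pow : Carrier → ℕ → Carrier
  pow x zero    = 1#
  pow x (suc n) = x * pow x n

  fromℕ : ℕ → Carrier
  fromℕ zero    = 0#
  fromℕ (suc n) = 1# + fromℕ n

  fromℤ : ℤ → Carrier
  fromℤ (+ n)    = fromℕ n
  fromℤ -[1+ n ] = - fromℕ (suc n)

  sumR : List Carrier → Carrier
  sumR = List.foldr _+_ 0#

  IsDomain : Set (c ⊔ ℓ)
  IsDomain = (¬ (1# ≈ 0#)) Data.Product.× (∀ x y → x * y ≈ 0# → x ≈ 0# ⊎ y ≈ 0#)
    where import Data.Product

  CharZero : Set ℓ
  CharZero = ∀ n → ¬ (fromℕ (suc n) ≈ 0#)

  IsPrimitiveRoot : Carrier → ℕ → Set ℓ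
  IsPrimitiveRoot ζ N =
    (pow ζ N ≈ 1#) Data.Product.× (∀ d → 0 ℕ.< d → d ℕ.< N → ¬ (pow ζ d ≈ 1#))
    where import Data.Product

  -- e(q) := ζ^(N q mod N); for ζ = e^{2πi/N} and N q ∈ ℤ this is e^{2πi q}.
  expζ : (ζ : Carrier) (N : ℕ) → .{{NonZero N}} → ℚ → Carrier
  expζ ζ N q = pow ζ (floor (q ℚ.* (+ N ℚ./ 1)) %ℕ N)

prodℕ : ∀ {k} → (Fin k → ℕ) → ℕ
prodℕ {zero}  f = 1
prodℕ {suc k} f = f zero ℕ.* prodℕ (λ s → f (suc s))

prodℕ-nonZero : ∀ {k} (f : Fin k → ℕ) → (∀ s → NonZero (f s)) → NonZero (prodℕ f)
prodℕ-nonZero {zero}  f pos = _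
prodℕ-nonZero {suc k} f pos =
  ℕP.m*n≢0 (f zero) (prodℕ (λ s → f (suc s)))
    {{pos zero}} {{prodℕ-nonZero (λ s → f (suc s)) (λ s → pos (suc s))}}

-- S(n, α), computed in R with ζ a primitive N-th root of unity, N = ∏ n_s.
-- The sum ranges over 1 ≤ m_s ≤ (n+1) n_s; every omitted tuple has
-- m_s > (n+1) n_s for some s, hence ⌊∑ m_s/n_s⌋ > n and a vanishing
-- binomial coefficient, so this is exactly the paper's (finite) sum.

module _ {c ℓ : Level} (R : CommutativeRing c ℓ) where
  open CommutativeRing R

  S : ∀ {k} (a : Fin k → ℤ) (ns : Fin k → ℕ) (pos : ∀ s → NonZero (ns s))
      (ζ : Carrier) (n : ℕ) (α : ℚ) → Carrier
  S {k} a ns pos ζ n α =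
    sumR R (map term (filter (λ ms → frac (T ms) ℚP.≟ α)
                             (tuples k (λ s → suc n ℕ.* ns s))))
    where
      T : (Fin k → ℕ) → ℚ
      T ms = wsum ns pos (λ _ → + 1) ms
      fl : (Fin k → ℕ) → ℕ
      fl ms = ℤ.∣ floor (T ms) ∣
      term : (Fin k → ℕ) → Carrier
      term ms = fromℤ R ((ℤ.- ℤ.1ℤ) ℤ.^ fl ms)
                * (fromℕ R (n C fl ms)
                * expζ R ζ (prodℕ ns) {{prodℕ-nonZero ns pos}} (wsum ns pos a ms))

{-# OPTIONS --safe #-}

-- Let N = ∏ n_s, w_s = ζ^{(a_s mod n_s) N/n_s} z^{N/n_s} and
--   G_n = (1 - z^N)^n ∏ w_s / (1 - w_s)  in R[[z]].
-- Expanding the geometric series, (-1)^n S(n, A/N) is the coefficient of z^{A + nN} in G_n for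
-- 0 ≤ A < N.  Since 1 - w_s is the product of the factors 1 - ζ^y z with y ≡ a_s (mod n_s), the
-- exponent of 1 - ζ^y z in the denominator of G_n is the number c(y) of classes containing y.
-- If c ≤ n, then G_n is a polynomial of degree nN with leading coefficient (-1)^{n+k}, which is the
-- asserted value of S(n, α).  Conversely, the asserted values for m ≤ n < k extend to all n ≥ m because
-- c ≤ k, and G_{n+1} = (1 - z^N) G_n then forces G_m to be a polynomial, whence c ≤ m.

module Submission where

open import Defs
open import Level using (Level; _⊔_)
open import Data.Bool.Base using (if_then_else_; true; false)
open import Data.Nat.Base as ℕ using (ℕ; zero; suc; NonZero; z≤n; s≤s; _≤_; _<_)
import Data.Nat.Properties as ℕP
import Data.Nat.DivMod as ℕDM
import Data.Nat.Divisibility as ℕD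
import Data.Nat.GCD as GCD
open import Data.Nat.Coprimality as Coprime using (1-coprimeTo)
open import Data.Nat.Combinatorics using (_C_; nCk≡nC[n∸k]; nCn≡1; nCk+nC[k+1]≡[n+1]C[k+1]; k>n⇒nCk≡0)
import Data.Nat.Tactic.RingSolver as ℕSolver
open import Data.Integer.Base as ℤ using (ℤ; +_; -[1+_])
import Data.Integer.Properties as ℤP
open import Data.Integer.DivMod using (_%ℕ_; _/ℕ_; n%ℕd<d; a≡a%ℕn+[a/ℕn]*n; div-pos-is-/ℕ)
open import Data.Integer.Divisibility.Signed as Signed using (divides; ∣ᵤ⇒∣; ∣⇒∣ᵤ)
open import Data.Integer.Tactic.RingSolver using (solve-∀)
open import Data.Rational.Base as ℚ using (ℚ; mkℚ; mkℚ+; floor; toℚᵘ; 0ℚ; 1ℚ)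
import Data.Rational.Properties as ℚP
open import Data.Rational.Unnormalised.Base as ℚᵘ using (mkℚᵘ; *≡*; *<*)
import Data.Rational.Unnormalised.Properties as ℚᵘP
open import Data.Fin.Base using (Fin; zero; suc; toℕ; fromℕ<; punchIn)
import Data.Fin.Properties as FinP
open import Data.List.Base using (List; []; _∷_; _++_; map; filter; concatMap; applyUpTo; upTo; length; allFin; tabulate)
open import Data.List.Properties using (filter-≐; length-filter; length-tabulate; map-applyUpTo; map-∘)
open import Data.Product.Base using (_,_; proj₁; proj₂; _×_; ∃)
open import Data.Sum.Base using (inj₁; inj₂)
import Data.Vec.Functional as VF
open import Function.Base using (_∘_; id)
open import Function.Bundles using (_⇔_; mk⇔)
open import Relation.Nullary using (¬_; contradiction)
open import Relation.Nullary.Decidable using (Dec; does; yes; no)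
open import Relation.Unary using (Decidable)
open import Relation.Binary.Definitions using (tri<; tri≈; tri>)
open import Relation.Binary.PropositionalEquality as ≡ using (_≡_; _≢_; cong; cong₂; subst)
import Relation.Binary.Reasoning.Setoid
open import Algebra.Bundles using (CommutativeRing)
import Algebra.Properties.CommutativeMonoid.Sum
import Algebra.Properties.Ring
import Algebra.Solver.Ring.NaturalCoefficients.Default

-- The scalars form only a domain R, so every division takes place in R[[z]], where 1 - ζ^y z has a
-- geometric series as inverse. The last implication, from a polynomial G_m to c ≤ m, then cannot be
-- settled by looking at a pole. If c(y₀) > m, all excess denominators but one are multiplied away,
-- and the numerator left over the single denominator 1 - ρ z, ρ = ζ^y₀, is a product of powers of
-- z, nonzero constants and linear factors 1 - σ z with σ different from ρ. Each of these satisfies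
-- a Bezout identity with 1 - ρ z whose left side is a nonzero constant, so it can be stripped from
-- the numerator without losing polynomiality. In the end the geometric series of ρ itself would
-- have to terminate, which is impossible in a domain. The prescribed values carry the sign
-- (-1)^(n+k) and therefore cancel for consecutive n. This cancellation is what makes the
-- coefficients of G_m vanish from some point on.

-- Integer arithmetic: the quotients N / n_s and residues.

cofactor : ∀ {k} → (Fin k → ℕ) → Fin k → ℕ
cofactor {suc k} ns zero    = prodℕ (ns ∘ suc)
cofactor {suc k} ns (suc s) = ns zero ℕ.* cofactor (ns ∘ suc) s

cofactor-* : ∀ {k} (ns : Fin k → ℕ) s → cofactor ns s ℕ.* ns s ≡ prodℕ ns
cofactor-* {suc k} ns zero    = ℕP.*-comm (prodℕ (ns ∘ suc)) (ns zero)
cofactor-* {suc k} ns (suc s) =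
  ≡.trans (ℕP.*-assoc (ns zero) _ _) (cong (ns zero ℕ.*_) (cofactor-* (ns ∘ suc) s))

sumℕ : ∀ {k} → (Fin k → ℕ) → ℕ
sumℕ {zero}  f = 0
sumℕ {suc k} f = f zero ℕ.+ sumℕ (f ∘ suc)

sumℤ : ∀ {k} → (Fin k → ℤ) → ℤ
sumℤ {zero}  f = + 0
sumℤ {suc k} f = f zero ℤ.+ sumℤ (f ∘ suc)

sumℤ-+ : ∀ {k} (f : Fin k → ℕ) → sumℤ (λ s → + f s) ≡ + sumℕ f
sumℤ-+ {zero}  f = ≡.refl
sumℤ-+ {suc k} f = ≡.trans (cong (λ i → + f zero ℤ.+ i) (sumℤ-+ (f ∘ suc))) (≡.sym (ℤP.pos-+ (f zero) _))

sumℤ-cong : ∀ {k} {f g : Fin k → ℤ} → (∀ s → f s ≡ g s) → sumℤ f ≡ sumℤ g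
sumℤ-cong {zero}  f≡g = ≡.refl
sumℤ-cong {suc k} f≡g = cong₂ ℤ._+_ (f≡g zero) (sumℤ-cong (f≡g ∘ suc))

sumℤ-affine : ∀ {k} (f g : Fin k → ℤ) n → sumℤ (λ s → f s ℤ.+ g s ℤ.* n) ≡ sumℤ f ℤ.+ sumℤ g ℤ.* n
sumℤ-affine {zero}  f g n = ≡.refl
sumℤ-affine {suc k} f g n = ≡.trans
  (cong (λ i → f zero ℤ.+ g zero ℤ.* n ℤ.+ i) (sumℤ-affine (f ∘ suc) (g ∘ suc) n))
  (rearrange (f zero) (g zero) (sumℤ (f ∘ suc)) (sumℤ (g ∘ suc)) n)
  where
  rearrange : ∀ a b c d n → a ℤ.+ b ℤ.* n ℤ.+ (c ℤ.+ d ℤ.* n) ≡ a ℤ.+ c ℤ.+ (b ℤ.+ d) ℤ.* n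
  rearrange = solve-∀

∣m-n∣≤m⊔n : ∀ m n → ℤ.∣ + m ℤ.- + n ∣ ≤ m ℕ.⊔ n
∣m-n∣≤m⊔n m n = subst (_≤ m ℕ.⊔ n) (cong ℤ.∣_∣ (≡.sym (ℤP.m-n≡m⊖n m n))) (ℤP.∣m⊝n∣≤m⊔n m n)

residue-unique : ∀ {n r r′} → r < n → r′ < n → + n Signed.∣ + r ℤ.- + r′ → r ≡ r′
residue-unique {n} {r} {r′} r<n r′<n n∣r-r′ with ℤ.∣ + r ℤ.- + r′ ∣ in eq
... | zero  = ℤP.+-injective (ℤP.i-j≡0⇒i≡j (+ r) (+ r′) (ℤP.∣i∣≡0⇒i≡0 eq))
... | suc d = contradiction (subst (n ℕD.∣_) eq (∣⇒∣ᵤ n∣r-r′))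
  (ℕD.>⇒∤ (ℕP.≤-<-trans (subst (_≤ r ℕ.⊔ r′) eq (∣m-n∣≤m⊔n r r′)) (ℕP.⊔-lub r<n r′<n)))

%ℕ-unique : ∀ i n .{{_ : NonZero n}} {r} → r < n → + n Signed.∣ + r ℤ.- i → i %ℕ n ≡ r
%ℕ-unique i n {r} r<n n∣r-i = ≡.sym (residue-unique r<n (n%ℕd<d i n)
  (subst (+ n Signed.∣_) (telescope (+ r) i (+ (i %ℕ n)))
    (Signed.∣m∣n⇒∣m+n n∣r-i (divides (i /ℕ n)
      (≡.trans (cong (λ u → u ℤ.- + (i %ℕ n)) (a≡a%ℕn+[a/ℕn]*n i n)) (cancel (+ (i %ℕ n)) _))))))
  where
  telescope : ∀ a b c → (a ℤ.- b) ℤ.+ (b ℤ.- c) ≡ a ℤ.- c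
  telescope = solve-∀
  cancel : ∀ a b → a ℤ.+ b ℤ.- a ≡ b
  cancel = solve-∀

%ℕ-+* : ∀ v q n .{{_ : NonZero n}} → (+ v ℤ.+ q ℤ.* + n) %ℕ n ≡ v ℕ.% n
%ℕ-+* v q n = %ℕ-unique (+ v ℤ.+ q ℤ.* + n) n (ℕDM.m%n<n v n) (divides (ℤ.- (+ (v ℕ./ n) ℤ.+ q))
  (≡.trans (cong (λ u → + (v ℕ.% n) ℤ.- (u ℤ.+ q ℤ.* + n)) (a≡a%ℕn+[a/ℕn]*n (+ v) n))
    (collect (+ (v ℕ.% n)) (+ (v ℕ./ n)) q (+ n))))
  where
  collect : ∀ r p q n → r ℤ.- (r ℤ.+ p ℤ.* n ℤ.+ q ℤ.* n) ≡ ℤ.- (p ℤ.+ q) ℤ.* n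
  collect = solve-∀

module _ (a : ℤ) (n : ℕ) .{{_ : NonZero n}} (j r : ℕ) (r<n : r < n) where
  private
    shift : ∀ j r n a → j ℤ.* n ℤ.+ r ℤ.- a ≡ (r ℤ.- a) ℤ.+ j ℤ.* n
    shift = solve-∀

    x-a : + (j ℕ.* n ℕ.+ r) ℤ.- a ≡ (+ r ℤ.- a) ℤ.+ + j ℤ.* + n
    x-a = ≡.trans (cong (ℤ._- a) (≡.trans (ℤP.pos-+ (j ℕ.* n) r) (cong (λ u → u ℤ.+ + r) (ℤP.pos-* j n))))
      (shift (+ j) (+ r) (+ n) a)

  congruent⇒residue : (+ (j ℕ.* n ℕ.+ r)) ≡ a [mod n ] → r ≡ a %ℕ n
  congruent⇒residue x≡a = ≡.sym (%ℕ-unique a n r<n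
    (Signed.∣m+n∣n⇒∣m (subst (+ n Signed.∣_) x-a (∣ᵤ⇒∣ x≡a)) (divides (+ j) ≡.refl)))

  residue⇒congruent : r ≡ a %ℕ n → (+ (j ℕ.* n ℕ.+ r)) ≡ a [mod n ]
  residue⇒congruent r≡ = ∣⇒∣ᵤ (subst (+ n Signed.∣_) (≡.sym x-a)
    (Signed.∣m∣n⇒∣m+n (divides (ℤ.- (a /ℕ n))
      (≡.trans (cong₂ ℤ._-_ (cong +_ r≡) (a≡a%ℕn+[a/ℕn]*n a n)) (drop (+ (a %ℕ n)) (a /ℕ n) (+ n))))
      (divides (+ j) ≡.refl)))
    where
    drop : ∀ r q n → r ℤ.- (r ℤ.+ q ℤ.* n) ≡ ℤ.- q ℤ.* n
    drop = solve-∀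

-- Every n_s divides N, so membership in each class depends on x modulo N only. This replaces the
-- integers by the N exponents of ζ.
coverCount-%ℕ : ∀ {k} (a : Fin k → ℤ) (ns : Fin k → ℕ) x .{{_ : NonZero (prodℕ ns)}} →
  coverCount a ns x ≡ coverCount a ns (+ (x %ℕ prodℕ ns))
coverCount-%ℕ {k} a ns x = cong length (filter-≐ _ _ ((λ {s} → to s) , (λ {s} → from s)) (allFin k))
  where
  N = prodℕ ns
  y = + (x %ℕ N)
  telescope : ∀ y q N a → (y ℤ.- a) ℤ.+ q ℤ.* N ≡ (y ℤ.+ q ℤ.* N) ℤ.- a
  telescope = solve-∀
  x-a : ∀ s → (y ℤ.- a s) ℤ.+ x /ℕ N ℤ.* + N ≡ x ℤ.- a s
  x-a s = ≡.trans (telescope y (x /ℕ N) (+ N) (a s)) (cong (ℤ._- a s) (≡.sym (a≡a%ℕn+[a/ℕn]*n x N)))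
  ns∣ : ∀ s → + ns s Signed.∣ x /ℕ N ℤ.* + N
  ns∣ s = Signed.∣n⇒∣m*n (x /ℕ N) (divides (+ cofactor ns s)
    (≡.trans (cong +_ (≡.sym (cofactor-* ns s))) (ℤP.pos-* (cofactor ns s) (ns s))))
  to : ∀ s → x ≡ (a s) [mod (ns s) ] → y ≡ (a s) [mod (ns s) ]
  to s p = ∣⇒∣ᵤ {i = y ℤ.- a s} (Signed.∣m+n∣n⇒∣m {m = y ℤ.- a s} (subst (+ ns s Signed.∣_) (≡.sym (x-a s)) (∣ᵤ⇒∣ p)) (ns∣ s))
  from : ∀ s → y ≡ (a s) [mod (ns s) ] → x ≡ (a s) [mod (ns s) ]
  from s p = ∣⇒∣ᵤ (subst (+ ns s Signed.∣_) (x-a s) (Signed.∣m∣n⇒∣m+n (∣ᵤ⇒∣ {i = y ℤ.- a s} p) (ns∣ s)))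

coverCount≤k : ∀ {k} (a : Fin k → ℤ) (ns : Fin k → ℕ) x → coverCount a ns x ≤ k
coverCount≤k {k} a ns x =
  subst (coverCount a ns x ≤_) (length-tabulate {n = k} id) (length-filter _ (allFin k))

-- Rational numbers over a common denominator.

/-≡ : ∀ i m j n .{{_ : NonZero m}} .{{_ : NonZero n}} → i ℤ.* + n ≡ j ℤ.* + m → i ℚ./ m ≡ j ℚ./ n
/-≡ i (suc m) j (suc n) eq = ℚP.fromℚᵘ-cong {mkℚᵘ i m} {mkℚᵘ j n} (*≡* eq)

/-+ : ∀ i j n .{{_ : NonZero n}} → i ℚ./ n ℚ.+ j ℚ./ n ≡ (i ℤ.+ j) ℚ./ n
/-+ i j (suc n) = ℚP.toℚᵘ-injective (begin
  toℚᵘ (i ℚ./ suc n ℚ.+ j ℚ./ suc n)             ≈⟨ ℚP.toℚᵘ-homo-+ (i ℚ./ suc n) (j ℚ./ suc n) ⟩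
  toℚᵘ (i ℚ./ suc n) ℚᵘ.+ toℚᵘ (j ℚ./ suc n)
    ≈⟨ ℚᵘP.+-cong (ℚP.toℚᵘ-fromℚᵘ (mkℚᵘ i n)) (ℚP.toℚᵘ-fromℚᵘ (mkℚᵘ j n)) ⟩
  mkℚᵘ i n ℚᵘ.+ mkℚᵘ j n                         ≈⟨ *≡* (combine i j (+ suc n) (ℤP.pos-* (suc n) (suc n))) ⟩
  mkℚᵘ (i ℤ.+ j) n                               ≈⟨ ℚP.toℚᵘ-fromℚᵘ (mkℚᵘ (i ℤ.+ j) n) ⟨
  toℚᵘ ((i ℤ.+ j) ℚ./ suc n)                     ∎)
  where
  open ℚᵘP.≃-Reasoning
  expand : ∀ i j n → (i ℤ.* n ℤ.+ j ℤ.* n) ℤ.* n ≡ (i ℤ.+ j) ℤ.* (n ℤ.* n)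
  expand = solve-∀
  -- `nn` stands for the cast of the natural product `suc n * suc n`; once it is abstracted, a
  -- polynomial identity in `n` remains.
  combine : ∀ i j n {nn} → nn ≡ n ℤ.* n → (i ℤ.* n ℤ.+ j ℤ.* n) ℤ.* n ≡ (i ℤ.+ j) ℤ.* nn
  combine i j n ≡.refl = expand i j n

/-* : ∀ i n .{{_ : NonZero n}} → i ℚ./ n ℚ.* (+ n ℚ./ 1) ≡ i ℚ./ 1
/-* i (suc n) = ℚP.toℚᵘ-injective (begin
  toℚᵘ (i ℚ./ suc n ℚ.* (+ suc n ℚ./ 1))           ≈⟨ ℚP.toℚᵘ-homo-* (i ℚ./ suc n) (+ suc n ℚ./ 1) ⟩
  toℚᵘ (i ℚ./ suc n) ℚᵘ.* toℚᵘ (+ suc n ℚ./ 1)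
    ≈⟨ ℚᵘP.*-cong (ℚP.toℚᵘ-fromℚᵘ (mkℚᵘ i n)) (ℚP.toℚᵘ-fromℚᵘ (mkℚᵘ (+ suc n) 0)) ⟩
  mkℚᵘ i n ℚᵘ.* mkℚᵘ (+ suc n) 0                   ≈⟨ *≡* (combine i (+ suc n) (ℤP.pos-* (suc n) 1)) ⟩
  mkℚᵘ i 0                                         ≈⟨ ℚP.toℚᵘ-fromℚᵘ (mkℚᵘ i 0) ⟨
  toℚᵘ (i ℚ./ 1)                                   ∎)
  where
  open ℚᵘP.≃-Reasoning
  expand : ∀ i n → i ℤ.* n ℤ.* + 1 ≡ i ℤ.* (n ℤ.* + 1)
  expand = solve-∀
  combine : ∀ i n {n1} → n1 ≡ n ℤ.* + 1 → i ℤ.* n ℤ.* + 1 ≡ i ℤ.* n1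
  combine i n ≡.refl = expand i n

/-injective : ∀ u v n .{{_ : NonZero n}} → + u ℚ./ n ≡ + v ℚ./ n → u ≡ v
/-injective u v (suc n) eq with ℚP.fromℚᵘ-injective {mkℚᵘ (+ u) n} {mkℚᵘ (+ v) n} eq
... | *≡* p = ℤP.+-injective (ℤP.*-cancelʳ-≡ (+ u) (+ v) (+ suc n) p)

0≤/ : ∀ v n .{{_ : NonZero n}} → 0ℚ ℚ.≤ + v ℚ./ n
0≤/ v n = ℚP.nonNegative⁻¹ (+ v ℚ./ n) {{ℚP.normalize-nonNeg v n}}

/<1 : ∀ {v} n .{{_ : NonZero n}} → v < n → + v ℚ./ n ℚ.< 1ℚ
/<1 {v} (suc n) v<n = ℚP.toℚᵘ-cancel-< (ℚᵘP.<-respˡ-≃ (ℚᵘP.≃-sym (ℚP.toℚᵘ-fromℚᵘ (mkℚᵘ (+ v) n)))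
  (*<* (≡.subst₂ ℤ._<_ (≡.sym (ℤP.*-identityʳ (+ v))) (≡.sym (ℤP.*-identityˡ (+ suc n))) (ℤ.+<+ v<n))))

floor-mkℚ+ : ∀ m n .{{_ : NonZero n}} .(c : Coprime.Coprime m n) → floor (mkℚ+ m n c) ≡ + (m ℕ./ n)
floor-mkℚ+ m (suc n) c = div-pos-is-/ℕ (+ m) (suc n)

-- A rational is stored in lowest terms, with `v` and `n` both divided by their gcd. Cancelling the
-- gcd does not change the natural quotient.
floor-/ : ∀ v n .{{_ : NonZero n}} → floor (+ v ℚ./ n) ≡ + (v ℕ./ n)
floor-/ v n = ≡.trans (floor-mkℚ+ (v ℕ./ g) (n ℕ./ g) (Coprime.coprime-/gcd v n)) (cong +_ (begin
  (v ℕ./ g) ℕ./ (n ℕ./ g)                     ≡⟨ ℕDM.m*n/o*n≡m/o (v ℕ./ g) g (n ℕ./ g) ⟨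
  (v ℕ./ g ℕ.* g) ℕ./ (n ℕ./ g ℕ.* g)         ≡⟨ ℕDM./-congˡ {o = n ℕ./ g ℕ.* g} (ℕDM.m/n*n≡m (GCD.gcd[m,n]∣m v n)) ⟩
  v ℕ./ (n ℕ./ g ℕ.* g)                       ≡⟨ ℕDM./-congʳ (ℕDM.m/n*n≡m (GCD.gcd[m,n]∣n v n)) ⟩
  v ℕ./ n                                     ∎))
  where
  open ≡.≡-Reasoning
  g = GCD.gcd v n
  instance
    g≢0 : NonZero g
    g≢0 = ℕ.≢-nonZero (GCD.gcd[m,n]≢0 v n (inj₂ (ℕ.≢-nonZero⁻¹ n)))
    n/g≢0 : NonZero (n ℕ./ g)
    n/g≢0 = ℕ.≢-nonZero (GCD.n/gcd[m,n]≢0 v n)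
    n/g*g≢0 : NonZero (n ℕ./ g ℕ.* g)
    n/g*g≢0 = ℕP.m*n≢0 (n ℕ./ g) g

floor-integer : ∀ i → floor (i ℚ./ 1) ≡ i
floor-integer i = begin
  floor (i ℚ./ 1)                         ≡⟨ cong floor (ℚP.↥p/↧p≡p (mkℚ i 0 (Coprime.sym (1-coprimeTo ℤ.∣ i ∣)))) ⟩
  i ℤ./ + 1                               ≡⟨ div-pos-is-/ℕ i 1 ⟩
  i /ℕ 1                                  ≡⟨ ℤP.*-identityʳ (i /ℕ 1) ⟨
  i /ℕ 1 ℤ.* + 1                          ≡⟨ ℤP.+-identityˡ _ ⟨
  + 0 ℤ.+ i /ℕ 1 ℤ.* + 1                  ≡⟨ cong (λ r → + r ℤ.+ i /ℕ 1 ℤ.* + 1) (ℕP.n<1⇒n≡0 (n%ℕd<d i 1)) ⟨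
  + (i %ℕ 1) ℤ.+ i /ℕ 1 ℤ.* + 1           ≡⟨ a≡a%ℕn+[a/ℕn]*n i 1 ⟨
  i                                       ∎
  where open ≡.≡-Reasoning

frac-/ : ∀ v n .{{_ : NonZero n}} → frac (+ v ℚ./ n) ≡ + (v ℕ.% n) ℚ./ n
frac-/ v n = begin
  + v ℚ./ n ℚ.- (floor (+ v ℚ./ n) ℚ./ 1)         ≡⟨ cong (λ f → + v ℚ./ n ℚ.- (f ℚ./ 1)) (floor-/ v n) ⟩
  + v ℚ./ n ℚ.- (+ q ℚ./ 1)
    ≡⟨ cong (λ f → + v ℚ./ n ℚ.- f) (/-≡ (+ q) 1 (+ q ℤ.* + n) n (≡.sym (ℤP.*-identityʳ _))) ⟩
  + v ℚ./ n ℚ.- ((+ q ℤ.* + n) ℚ./ n)             ≡⟨ cong (ℚ._- ((+ q ℤ.* + n) ℚ./ n)) split ⟩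
  + r ℚ./ n ℚ.+ qn ℚ.- qn                         ≡⟨ ℚP.+-assoc (+ r ℚ./ n) qn (ℚ.- qn) ⟩
  + r ℚ./ n ℚ.+ (qn ℚ.- qn)                       ≡⟨ cong (+ r ℚ./ n ℚ.+_) (ℚP.+-inverseʳ qn) ⟩
  + r ℚ./ n ℚ.+ 0ℚ                                ≡⟨ ℚP.+-identityʳ _ ⟩
  + r ℚ./ n                                       ∎
  where
  open ≡.≡-Reasoning
  q = v ℕ./ n
  r = v ℕ.% n
  qn = (+ q ℤ.* + n) ℚ./ n
  split : + v ℚ./ n ≡ + r ℚ./ n ℚ.+ qn
  split = ≡.trans (cong (ℚ._/ n) (a≡a%ℕn+[a/ℕn]*n (+ v) n)) (≡.sym (/-+ (+ r) (+ q ℤ.* + n) n))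

sumℚ-/ : ∀ {k} (f : Fin k → ℤ) n .{{_ : NonZero n}} → sumℚ (λ s → f s ℚ./ n) ≡ sumℤ f ℚ./ n
sumℚ-/ {zero}  f n = /-≡ (+ 0) 1 (+ 0) n ≡.refl
sumℚ-/ {suc k} f n = ≡.trans (cong (f zero ℚ./ n ℚ.+_) (sumℚ-/ (f ∘ suc) n)) (/-+ (f zero) _ n)

sumℚ-cong : ∀ {k} {f g : Fin k → ℚ} → (∀ s → f s ≡ g s) → sumℚ f ≡ sumℚ g
sumℚ-cong {zero}  f≡g = ≡.refl
sumℚ-cong {suc k} f≡g = cong₂ ℚ._+_ (f≡g zero) (sumℚ-cong (f≡g ∘ suc))

module WeightedSums {k} (ns : Fin k → ℕ) (pos : ∀ s → NonZero (ns s)) (ms : Fin k → ℕ) where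
  private
    N = prodℕ ns
    instance
      N≢0 : NonZero N
      N≢0 = prodℕ-nonZero ns pos

  -- This is N times the sum of the r_s m_s / n_s. For r = 1 it is the exponent of z in the product
  -- of the w_s^(m_s); for r_s the residue of a_s it is the exponent of ζ.
  weight : (Fin k → ℕ) → ℕ
  weight r = sumℕ (λ s → r s ℕ.* ms s ℕ.* cofactor ns s)

  wsum-/ : ∀ c → wsum ns pos c ms ≡ sumℤ (λ s → c s ℤ.* + ms s ℤ.* + cofactor ns s) ℚ./ N
  wsum-/ c = ≡.trans (sumℚ-cong term) (sumℚ-/ (λ s → c s ℤ.* + ms s ℤ.* + cofactor ns s) N)
    where
    term : ∀ s → ℚ._/_ (c s ℤ.* + ms s) (ns s) {{pos s}} ≡ (c s ℤ.* + ms s ℤ.* + cofactor ns s) ℚ./ N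
    term s = /-≡ (c s ℤ.* + ms s) (ns s) (c s ℤ.* + ms s ℤ.* + cofactor ns s) N {{pos s}}
      (≡.trans (cong (λ u → c s ℤ.* + ms s ℤ.* u) (≡.trans (cong +_ (≡.sym (cofactor-* ns s)))
          (ℤP.pos-* (cofactor ns s) (ns s))))
        (≡.sym (ℤP.*-assoc (c s ℤ.* + ms s) (+ cofactor ns s) (+ ns s))))

  pos-weight : ∀ r → sumℤ (λ s → + r s ℤ.* + ms s ℤ.* + cofactor ns s) ≡ + weight r
  pos-weight r = ≡.trans (sumℤ-cong (λ s → ≡.sym (≡.trans (ℤP.pos-* (r s ℕ.* ms s) (cofactor ns s))
    (cong (λ u → u ℤ.* + cofactor ns s) (ℤP.pos-* (r s) (ms s)))))) (sumℤ-+ (λ s → r s ℕ.* ms s ℕ.* cofactor ns s))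

  wsum-one : wsum ns pos (λ _ → + 1) ms ≡ + weight (λ _ → 1) ℚ./ N
  wsum-one = ≡.trans (wsum-/ (λ _ → + 1)) (cong (ℚ._/ N) (pos-weight (λ _ → 1)))

  floor-wsum-one : floor (wsum ns pos (λ _ → + 1) ms) ≡ + (weight (λ _ → 1) ℕ./ N)
  floor-wsum-one = ≡.trans (cong floor wsum-one) (floor-/ (weight (λ _ → 1)) N)

  frac-wsum-one : frac (wsum ns pos (λ _ → + 1) ms) ≡ + (weight (λ _ → 1) ℕ.% N) ℚ./ N
  frac-wsum-one = ≡.trans (cong frac wsum-one) (frac-/ (weight (λ _ → 1)) N)

  -- Replacing a_s by its residue modulo n_s changes the s-th term by q m_s (N / n_s) n_s, with q
  -- the quotient of the division. This is a multiple of N and disappears modulo N.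
  exponent-wsum : ∀ a → floor (wsum ns pos a ms ℚ.* (+ N ℚ./ 1)) %ℕ N
    ≡ weight (λ s → _%ℕ_ (a s) (ns s) {{pos s}}) ℕ.% N
  exponent-wsum a = begin
    floor (wsum ns pos a ms ℚ.* (+ N ℚ./ 1)) %ℕ N   ≡⟨ cong (λ q → floor (q ℚ.* (+ N ℚ./ 1)) %ℕ N) (wsum-/ a) ⟩
    floor (V ℚ./ N ℚ.* (+ N ℚ./ 1)) %ℕ N            ≡⟨ cong (λ q → floor q %ℕ N) (/-* V N) ⟩
    floor (V ℚ./ 1) %ℕ N                            ≡⟨ cong (_%ℕ N) (floor-integer V) ⟩
    V %ℕ N                                          ≡⟨ cong (_%ℕ N) V≡ ⟩
    (+ weight r ℤ.+ sumℤ (λ s → q s ℤ.* + ms s) ℤ.* + N) %ℕ N ≡⟨ %ℕ-+* (weight r) (sumℤ (λ s → q s ℤ.* + ms s)) N ⟩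
    weight r ℕ.% N                                  ∎
    where
    open ≡.≡-Reasoning
    V = sumℤ (λ s → a s ℤ.* + ms s ℤ.* + cofactor ns s)
    r = λ s → _%ℕ_ (a s) (ns s) {{pos s}}
    q = λ s → _/ℕ_ (a s) (ns s) {{pos s}}
    regroup : ∀ r q n m c → (r ℤ.+ q ℤ.* n) ℤ.* m ℤ.* c ≡ r ℤ.* m ℤ.* c ℤ.+ q ℤ.* m ℤ.* (c ℤ.* n)
    regroup = solve-∀
    term : ∀ s → a s ℤ.* + ms s ℤ.* + cofactor ns s
      ≡ + r s ℤ.* + ms s ℤ.* + cofactor ns s ℤ.+ q s ℤ.* + ms s ℤ.* + N
    term s = ≡.trans (cong (λ a → a ℤ.* + ms s ℤ.* + cofactor ns s) (a≡a%ℕn+[a/ℕn]*n (a s) (ns s) {{pos s}}))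
      (≡.trans (regroup (+ r s) (q s) (+ ns s) (+ ms s) (+ cofactor ns s))
        (cong (λ n → + r s ℤ.* + ms s ℤ.* + cofactor ns s ℤ.+ q s ℤ.* + ms s ℤ.* n)
          (≡.trans (≡.sym (ℤP.pos-* (cofactor ns s) (ns s))) (cong +_ (cofactor-* ns s)))))
    V≡ : V ≡ + weight r ℤ.+ sumℤ (λ s → q s ℤ.* + ms s) ℤ.* + N
    V≡ = ≡.trans (sumℤ-cong term) (≡.trans
      (sumℤ-affine (λ s → + r s ℤ.* + ms s ℤ.* + cofactor ns s) (λ s → q s ℤ.* + ms s) (+ N))
      (cong (λ u → u ℤ.+ sumℤ (λ s → q s ℤ.* + ms s) ℤ.* + N) (pos-weight r)))

-- Products and powers in commutative rings and domains.

module RingLemmas {c ℓ : Level} (R : CommutativeRing c ℓ) where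
  open CommutativeRing R hiding (zero)
  open Algebra.Properties.Ring ring public
    using (-1*x≈-x; -‿distribˡ-*; -‿distribʳ-*; -‿involutive; -0#≈0#; x∙y⁻¹≈ε⇒x≈y)
  open Algebra.Solver.Ring.NaturalCoefficients.Default commutativeSemiring public
    using (solve; _:+_; _:*_; _:=_; con)
  private module Prod = Algebra.Properties.CommutativeMonoid.Sum *-commutativeMonoid
  open Relation.Binary.Reasoning.Setoid setoid

  prod : ∀ n → (Fin n → Carrier) → Carrier
  prod n = Prod.sum {n}

  prod-cong : ∀ n {f g : Fin n → Carrier} → (∀ i → f i ≈ g i) → prod n f ≈ prod n g
  prod-cong n = Prod.sum-cong-≋ {n}

  prod-distrib-* : ∀ n (f g : Fin n → Carrier) → prod n (λ i → f i * g i) ≈ prod n f * prod n g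
  prod-distrib-* n = Prod.∑-distrib-+ {n}

  prod-comm : ∀ m n (f : Fin m → Fin n → Carrier) →
    prod m (λ i → prod n (f i)) ≈ prod n (λ j → prod m (λ i → f i j))
  prod-comm m n = Prod.∑-comm {m} {n}

  _^_ : Carrier → ℕ → Carrier
  _^_ = pow R
  infixr 8 _^_

  ^-congˡ : ∀ n {x y} → x ≈ y → x ^ n ≈ y ^ n
  ^-congˡ zero    x≈y = refl
  ^-congˡ (suc n) x≈y = *-cong x≈y (^-congˡ n x≈y)

  ^-congʳ : ∀ x {m n} → m ≡ n → x ^ m ≈ x ^ n
  ^-congʳ x ≡.refl = refl

  ^-+ : ∀ x m n → x ^ (m ℕ.+ n) ≈ x ^ m * x ^ n
  ^-+ x zero    n = sym (*-identityˡ _)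
  ^-+ x (suc m) n = trans (*-congˡ (^-+ x m n)) (sym (*-assoc _ _ _))

  ^-* : ∀ x m n → x ^ (m ℕ.* n) ≈ (x ^ n) ^ m
  ^-* x zero    n = refl
  ^-* x (suc m) n = trans (^-+ x n (m ℕ.* n)) (*-congˡ (^-* x m n))

  ^-distrib-* : ∀ x y n → (x * y) ^ n ≈ x ^ n * y ^ n
  ^-distrib-* x y zero    = sym (*-identityˡ _)
  ^-distrib-* x y (suc n) = trans (*-congˡ (^-distrib-* x y n))
    (solve 4 (λ x y a b → (x :* y) :* (a :* b) := (x :* a) :* (y :* b)) refl x y (x ^ n) (y ^ n))

  1^ : ∀ n → 1# ^ n ≈ 1#
  1^ zero    = refl
  1^ (suc n) = trans (*-identityˡ _) (1^ n)

  prod-^ : ∀ {k} (f : Fin k → Carrier) n → prod k f ^ n ≈ prod k (λ i → f i ^ n)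
  prod-^ {zero}  f n = 1^ n
  prod-^ {suc k} f n = trans (^-distrib-* _ _ n) (*-congˡ (prod-^ (f ∘ suc) n))

  prod-range-last : ∀ n (f : ℕ → Carrier) → prod (suc n) (f ∘ toℕ) ≈ prod n (f ∘ toℕ) * f n
  prod-range-last zero    f = *-comm _ _
  prod-range-last (suc n) f = trans (*-congˡ (prod-range-last n (f ∘ suc))) (sym (*-assoc _ _ _))

  prod-range-+ : ∀ m n (f : ℕ → Carrier) →
    prod (m ℕ.+ n) (f ∘ toℕ) ≈ prod m (f ∘ toℕ) * prod n (λ i → f (m ℕ.+ toℕ i))
  prod-range-+ zero    n f = sym (*-identityˡ _)
  prod-range-+ (suc m) n f = trans (*-congˡ (prod-range-+ m n (f ∘ suc))) (sym (*-assoc _ _ _))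

  -- Reindexing by division with remainder, x = j n + r. It serves to cut the N exponents of ζ into
  -- blocks of n_s consecutive ones.
  prod-range-* : ∀ m n (f : ℕ → Carrier) →
    prod (m ℕ.* n) (f ∘ toℕ) ≈ prod m (λ j → prod n (λ r → f (toℕ j ℕ.* n ℕ.+ toℕ r)))
  prod-range-* zero    n f = refl
  prod-range-* (suc m) n f = begin
    prod (n ℕ.+ m ℕ.* n) (f ∘ toℕ)
      ≈⟨ prod-range-+ n (m ℕ.* n) f ⟩
    prod n (f ∘ toℕ) * prod (m ℕ.* n) (λ i → f (n ℕ.+ toℕ i))
      ≈⟨ *-congˡ (prod-range-* m n (λ i → f (n ℕ.+ i))) ⟩
    prod n (f ∘ toℕ) * prod m (λ j → prod n (λ r → f (n ℕ.+ (toℕ j ℕ.* n ℕ.+ toℕ r))))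
      ≈⟨ *-congˡ (prod-cong m (λ j → prod-cong n (λ r →
           reflexive (≡.cong f (≡.sym (ℕP.+-assoc n (toℕ j ℕ.* n) (toℕ r))))))) ⟩
    prod n (f ∘ toℕ) * prod m (λ j → prod n (λ r → f (n ℕ.+ toℕ j ℕ.* n ℕ.+ toℕ r)))
      ∎

  prod-trivial : ∀ n {f : Fin n → Carrier} → (∀ i → f i ≈ 1#) → prod n f ≈ 1#
  prod-trivial n f≈1 = trans (prod-cong n f≈1) (Prod.sum-replicate-zero n)

  prod-single : ∀ {n} (i : Fin n) (f : Fin n → Carrier) →
    (∀ j → j ≢ i → f j ≈ 1#) → prod n f ≈ f i
  prod-single {suc n} i f f≈1 = trans (Prod.sum-remove {i = i} f)
    (trans (*-congˡ (prod-trivial n (λ j → f≈1 (punchIn i j) (FinP.punchInᵢ≢i i j)))) (*-identityʳ _))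

  -- Turns counting into an exponent: for `f = id` the list is `allFin k`, and the length becomes
  -- `coverCount`.
  prod-filter : ∀ {a p} {A : Set a} {P : A → Set p} (P? : Decidable P) x {k} (f : Fin k → A) →
    prod k (λ s → if does (P? (f s)) then x else 1#) ≈ x ^ length (filter P? (tabulate f))
  prod-filter P? x {zero}  f = refl
  prod-filter P? x {suc k} f with P? (f zero)
  ... | yes _ = *-congˡ (prod-filter P? x (f ∘ suc))
  ... | no  _ = trans (*-identityˡ _) (prod-filter P? x (f ∘ suc))

  inverse-^ : ∀ {x y} → x * y ≈ 1# → ∀ n → x ^ n * y ^ n ≈ 1#
  inverse-^ {x} {y} xy n = trans (sym (^-distrib-* x y n)) (trans (^-congˡ n xy) (1^ n))

  ^-*-inverse^ : ∀ {x y} → x * y ≈ 1# → ∀ {m n} → m ≤ n → x ^ n * y ^ m ≈ x ^ (n ℕ.∸ m)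
  ^-*-inverse^ {x} {y} xy {m} {n} m≤n = begin
    x ^ n * y ^ m                     ≈⟨ *-congʳ (^-congʳ x (≡.sym (ℕP.m∸n+n≡m m≤n))) ⟩
    x ^ (n ℕ.∸ m ℕ.+ m) * y ^ m       ≈⟨ *-congʳ (^-+ x (n ℕ.∸ m) m) ⟩
    x ^ (n ℕ.∸ m) * x ^ m * y ^ m     ≈⟨ *-assoc _ _ _ ⟩
    x ^ (n ℕ.∸ m) * (x ^ m * y ^ m)   ≈⟨ *-congˡ (inverse-^ xy m) ⟩
    x ^ (n ℕ.∸ m) * 1#                ≈⟨ *-identityʳ _ ⟩
    x ^ (n ℕ.∸ m)                     ∎

module DomainLemmas {c ℓ : Level} (R : CommutativeRing c ℓ) (dom : IsDomain R) where
  open CommutativeRing R hiding (zero)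
  open RingLemmas R

  1≉0 : ¬ (1# ≈ 0#)
  1≉0 = proj₁ dom

  *-zero-cancelˡ : ∀ {x y} → ¬ (x ≈ 0#) → x * y ≈ 0# → y ≈ 0#
  *-zero-cancelˡ {x} {y} x≉0 xy≈0 with proj₂ dom x y xy≈0
  ... | inj₁ x≈0 = contradiction x≈0 x≉0
  ... | inj₂ y≈0 = y≈0

  *-nonzero : ∀ {x y} → ¬ (x ≈ 0#) → ¬ (y ≈ 0#) → ¬ (x * y ≈ 0#)
  *-nonzero x≉0 y≉0 xy≈0 = y≉0 (*-zero-cancelˡ x≉0 xy≈0)

  ^-nonzero : ∀ {x} n → ¬ (x ≈ 0#) → ¬ (x ^ n ≈ 0#)
  ^-nonzero zero    x≉0 = 1≉0
  ^-nonzero (suc n) x≉0 = *-nonzero x≉0 (^-nonzero n x≉0)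

  -‿nonzero : ∀ {x} → ¬ (x ≈ 0#) → ¬ (- x ≈ 0#)
  -‿nonzero {x} x≉0 -x≈0 = x≉0 (trans (sym (-‿involutive x)) (trans (-‿cong -x≈0) -0#≈0#))

  *-cancelˡ-nonzero : ∀ {x y z} → ¬ (x ≈ 0#) → x * y ≈ x * z → y ≈ z
  *-cancelˡ-nonzero {x} {y} {z} x≉0 xy≈xz = x∙y⁻¹≈ε⇒x≈y y z (*-zero-cancelˡ x≉0
    (trans (distribˡ x y (- z)) (trans (+-cong xy≈xz (sym (-‿distribʳ-* x z))) (-‿inverseʳ _))))

  prod-nonzero : ∀ k (t : Fin k → Carrier) → (∀ s → ¬ (t s ≈ 0#)) → ¬ (prod k t ≈ 0#)
  prod-nonzero zero    t t≉0 = 1≉0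
  prod-nonzero (suc k) t t≉0 = *-nonzero (t≉0 zero) (prod-nonzero k (t ∘ suc) (t≉0 ∘ suc))

-- The ring of formal power series.

module PowerSeries {c ℓ : Level} (R : CommutativeRing c ℓ) where
  open CommutativeRing R hiding (zero)
  open RingLemmas R using (solve; _:+_; _:*_; _:=_)
  open Relation.Binary.Reasoning.Setoid setoid

  Series : Set c
  Series = ℕ → Carrier

  -- Wrapped in a record so that unification can recover `f` and `g` from the type of a proof; a
  -- bare pointwise function type would not determine them.
  record _≋_ (f g : Series) : Set ℓ where
    constructor coeffwise
    field at : ∀ i → f i ≈ g i
  open _≋_ public
  infix 4 _≋_

  constant : Carrier → Series
  constant x zero    = x
  constant x (suc _) = 0#

  -- The Cauchy product comes from f = f₀ + z f′ with f′ = `f ∘ suc`. Recursion on the index lets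
  -- the ring laws be proved without finite sums.
  _⊕_ _⊛_ : Series → Series → Series
  (f ⊕ g) i = f i + g i
  (f ⊛ g) zero    = f 0 * g 0
  (f ⊛ g) (suc n) = f 0 * g (suc n) + ((f ∘ suc) ⊛ g) n
  infixl 6 _⊕_
  infixl 7 _⊛_

  -- A coefficient of a product sees no higher coefficients of the factors. The hypotheses stop at
  -- `n` so that truncated sums can be exchanged for full series.
  ⊛-cong-at : ∀ {f f′ g g′} n → (∀ i → i ℕ.≤ n → f i ≈ f′ i) → (∀ i → i ℕ.≤ n → g i ≈ g′ i) →
    (f ⊛ g) n ≈ (f′ ⊛ g′) n
  ⊛-cong-at zero    p q = *-cong (p 0 ℕ.z≤n) (q 0 ℕ.z≤n)
  ⊛-cong-at (suc n) p q = +-cong (*-cong (p 0 ℕ.z≤n) (q (suc n) ℕP.≤-refl))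
    (⊛-cong-at n (λ i i≤n → p (suc i) (ℕ.s≤s i≤n)) (λ i i≤n → q i (ℕP.m≤n⇒m≤1+n i≤n)))

  ⊛-distribʳ : ∀ h f g n → ((f ⊕ g) ⊛ h) n ≈ (f ⊛ h) n + (g ⊛ h) n
  ⊛-distribʳ h f g zero    = distribʳ _ _ _
  ⊛-distribʳ h f g (suc n) = trans (+-cong (distribʳ _ _ _) (⊛-distribʳ h (f ∘ suc) (g ∘ suc) n))
    (solve 4 (λ a b c d → (a :+ b) :+ (c :+ d) := (a :+ c) :+ (b :+ d)) refl _ _ _ _)

  ⊛-scale : ∀ x f g n → ((λ i → x * f i) ⊛ g) n ≈ x * (f ⊛ g) n
  ⊛-scale x f g zero    = *-assoc _ _ _
  ⊛-scale x f g (suc n) = trans (+-cong (*-assoc _ _ _) (⊛-scale x (f ∘ suc) g n)) (sym (distribˡ _ _ _))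

  ⊛-assoc : ∀ f g h n → ((f ⊛ g) ⊛ h) n ≈ (f ⊛ (g ⊛ h)) n
  ⊛-assoc f g h zero    = *-assoc _ _ _
  ⊛-assoc f g h (suc n) = begin
    f 0 * g 0 * h (suc n) + (((λ i → f 0 * g (suc i)) ⊕ ((f ∘ suc) ⊛ g)) ⊛ h) n
      ≈⟨ +-congˡ (⊛-distribʳ h _ _ n) ⟩
    f 0 * g 0 * h (suc n) + (((λ i → f 0 * g (suc i)) ⊛ h) n + (((f ∘ suc) ⊛ g) ⊛ h) n)
      ≈⟨ +-congˡ (+-cong (⊛-scale (f 0) (g ∘ suc) h n) (⊛-assoc (f ∘ suc) g h n)) ⟩
    f 0 * g 0 * h (suc n) + (f 0 * ((g ∘ suc) ⊛ h) n + ((f ∘ suc) ⊛ (g ⊛ h)) n)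
      ≈⟨ solve 5 (λ a b c d e → a :* b :* c :+ (a :* d :+ e) := a :* (b :* c :+ d) :+ e) refl
           (f 0) (g 0) (h (suc n)) (((g ∘ suc) ⊛ h) n) (((f ∘ suc) ⊛ (g ⊛ h)) n) ⟩
    f 0 * (g 0 * h (suc n) + ((g ∘ suc) ⊛ h) n) + ((f ∘ suc) ⊛ (g ⊛ h)) n
      ∎

  -- The mirror image of the defining recursion, splitting the second factor; commutativity follows
  -- by comparing the two.
  ⊛-peelʳ : ∀ f g n → (f ⊛ g) (suc n) ≈ f (suc n) * g 0 + (f ⊛ (g ∘ suc)) n
  ⊛-peelʳ f g zero    = +-comm _ _
  ⊛-peelʳ f g (suc n) = trans (+-congˡ (⊛-peelʳ (f ∘ suc) g n))
    (solve 3 (λ a b c → a :+ (b :+ c) := b :+ (a :+ c)) refl _ _ _)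

  ⊛-comm : ∀ f g n → (f ⊛ g) n ≈ (g ⊛ f) n
  ⊛-comm f g zero    = *-comm _ _
  ⊛-comm f g (suc n) = trans (+-cong (*-comm _ _) (⊛-comm (f ∘ suc) g n)) (sym (⊛-peelʳ g f n))

  ⊛-zeroˡ : ∀ g n → ((λ _ → 0#) ⊛ g) n ≈ 0#
  ⊛-zeroˡ g zero    = zeroˡ _
  ⊛-zeroˡ g (suc n) = trans (+-cong (zeroˡ _) (⊛-zeroˡ g n)) (+-identityˡ _)

  constant-⊛ : ∀ x g n → (constant x ⊛ g) n ≈ x * g n
  constant-⊛ x g zero    = refl
  constant-⊛ x g (suc n) = trans (+-congˡ (⊛-zeroˡ g n)) (+-identityʳ _)

  ⊛-identityˡ : ∀ g n → (constant 1# ⊛ g) n ≈ g n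
  ⊛-identityˡ g n = trans (constant-⊛ 1# g n) (*-identityˡ _)

  -- With this bundle the ring lemmas and the solver apply to R[[z]] as well as to R.
  seriesRing : CommutativeRing c ℓ
  seriesRing = record
    { Carrier = Series ; _≈_ = _≋_ ; _+_ = _⊕_ ; _*_ = _⊛_ ; -_ = λ f i → - f i
    ; 0# = λ _ → 0# ; 1# = constant 1#
    ; isCommutativeRing = record
      { isRing = record
        { +-isAbelianGroup = record
          { isGroup = record
            { isMonoid = record
              { isSemigroup = record
                { isMagma = record
                  { isEquivalence = record
                    { refl  = coeffwise λ _ → refl
                    ; sym   = λ p → coeffwise λ i → sym (at p i)
                    ; trans = λ p q → coeffwise λ i → trans (at p i) (at q i) }
                  ; ∙-cong = λ p q → coeffwise λ i → +-cong (at p i) (at q i) }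
                ; assoc = λ _ _ _ → coeffwise λ _ → +-assoc _ _ _ }
              ; identity = (λ _ → coeffwise λ _ → +-identityˡ _) , (λ _ → coeffwise λ _ → +-identityʳ _) }
            ; inverse = (λ _ → coeffwise λ _ → -‿inverseˡ _) , (λ _ → coeffwise λ _ → -‿inverseʳ _)
            ; ⁻¹-cong = λ p → coeffwise λ i → -‿cong (at p i) }
          ; comm = λ _ _ → coeffwise λ _ → +-comm _ _ }
        ; *-cong = λ p q → coeffwise λ n → ⊛-cong-at n (λ i _ → at p i) (λ i _ → at q i)
        ; *-assoc = λ f g h → coeffwise (⊛-assoc f g h)
        ; *-identity = (λ f → coeffwise (⊛-identityˡ f))
                     , (λ f → coeffwise λ n → trans (⊛-comm f (constant 1#) n) (⊛-identityˡ f n))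
        ; distrib = (λ f g h → coeffwise λ n → trans (⊛-comm f (g ⊕ h) n)
                      (trans (⊛-distribʳ f g h n) (+-cong (⊛-comm g f n) (⊛-comm h f n))))
                  , (λ f g h → coeffwise (⊛-distribʳ f g h)) }
      ; *-comm = λ f g → coeffwise (⊛-comm f g) } }

-- Monomials, degrees and dilations of power series.

module Polynomials {c ℓ : Level} (R : CommutativeRing c ℓ) where
  open CommutativeRing R hiding (zero)
  open RingLemmas R
  open PowerSeries R
  module 𝕊 = CommutativeRing seriesRing
  module 𝕃 = RingLemmas seriesRing
  open Relation.Binary.Reasoning.Setoid setoid

  coefficient-sum : ∀ {b} {B : Set b} f (g : B → Series) i xs →
    sumR R (map (λ x → (f ⊛ g x) i) xs) ≈ (f ⊛ sumR seriesRing (map g xs)) i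
  coefficient-sum f g i []       = sym (at (𝕊.zeroʳ f) i)
  coefficient-sum f g i (x ∷ xs) = trans (+-congˡ (coefficient-sum f g i xs))
    (sym (at (𝕊.distribˡ f (g x) (sumR seriesRing (map g xs))) i))

  prod-cong-below : ∀ n {k} {f g : Fin k → Series} → (∀ s i → i < n → f s i ≈ g s i) →
    ∀ i → i < n → 𝕃.prod k f i ≈ 𝕃.prod k g i
  prod-cong-below n {zero}  f≈g i i<n = refl
  prod-cong-below n {suc k} f≈g i i<n = ⊛-cong-at i
    (λ j j≤i → f≈g zero j (ℕP.≤-<-trans j≤i i<n))
    (λ j j≤i → prod-cong-below n (f≈g ∘ suc) j (ℕP.≤-<-trans j≤i i<n))

  monomial : Carrier → ℕ → Series
  monomial x zero            = constant x
  monomial x (suc e) zero    = 0#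
  monomial x (suc e) (suc i) = monomial x e i

  monomial-⊛-≥ : ∀ x e f i → (monomial x e ⊛ f) (e ℕ.+ i) ≈ x * f i
  monomial-⊛-≥ x zero    f i = constant-⊛ x f i
  monomial-⊛-≥ x (suc e) f i = trans (+-cong (zeroˡ _) (monomial-⊛-≥ x e f i)) (+-identityˡ _)

  monomial-⊛-< : ∀ x {e} f {i} → i < e → (monomial x e ⊛ f) i ≈ 0#
  monomial-⊛-< x {suc e} f {zero}  i<e       = zeroˡ _
  monomial-⊛-< x {suc e} f {suc i} (s≤s i<e) =
    trans (+-cong (zeroˡ _) (monomial-⊛-< x f i<e)) (+-identityˡ _)

  monomial-diagonal : ∀ x e → monomial x e e ≈ x
  monomial-diagonal x zero    = refl
  monomial-diagonal x (suc e) = monomial-diagonal x e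

  monomial-offDiagonal : ∀ x {e i} → e ≢ i → monomial x e i ≈ 0#
  monomial-offDiagonal x {zero}  {zero}  e≢i = contradiction ≡.refl e≢i
  monomial-offDiagonal x {zero}  {suc i} e≢i = refl
  monomial-offDiagonal x {suc e} {zero}  e≢i = refl
  monomial-offDiagonal x {suc e} {suc i} e≢i = monomial-offDiagonal x (e≢i ∘ ≡.cong suc)

  monomial-+ : ∀ x m e i → monomial x (m ℕ.+ e) (m ℕ.+ i) ≈ monomial x e i
  monomial-+ x zero    e i = refl
  monomial-+ x (suc m) e i = monomial-+ x m e i

  monomial-scale : ∀ y x e i → monomial (y * x) e i ≈ y * monomial x e i
  monomial-scale y x zero    zero    = refl
  monomial-scale y x zero    (suc i) = sym (zeroʳ y)
  monomial-scale y x (suc e) zero    = sym (zeroʳ y)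
  monomial-scale y x (suc e) (suc i) = monomial-scale y x e i

  monomial-cong : ∀ {x y} e → x ≈ y → monomial x e ≋ monomial y e
  monomial-cong e x≈y = coeffwise (go e)
    where
    go : ∀ e i → monomial _ e i ≈ monomial _ e i
    go zero    zero    = x≈y
    go zero    (suc i) = refl
    go (suc e) zero    = refl
    go (suc e) (suc i) = go e i

  monomial-⊛-monomial : ∀ x e y d → monomial x e ⊛ monomial y d ≋ monomial (x * y) (e ℕ.+ d)
  monomial-⊛-monomial x e y d = coeffwise (go e)
    where
    go : ∀ e i → (monomial x e ⊛ monomial y d) i ≈ monomial (x * y) (e ℕ.+ d) i
    go zero    i       = trans (constant-⊛ x (monomial y d) i) (sym (monomial-scale x y d i))
    go (suc e) zero    = zeroˡ _
    go (suc e) (suc i) = trans (+-cong (zeroˡ _) (go e i)) (+-identityˡ _)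

  monomial-^ : ∀ x e n → monomial x e 𝕃.^ n ≋ monomial (x ^ n) (n ℕ.* e)
  monomial-^ x e zero    = 𝕊.refl
  monomial-^ x e (suc n) = 𝕊.trans (𝕊.*-congˡ (monomial-^ x e n)) (monomial-⊛-monomial x e _ _)

  binomial : Carrier → ℕ → Series
  binomial x e = 𝕊.1# 𝕊.- monomial x e

  binomial-cong : ∀ {x y} e → x ≈ y → binomial x e ≋ binomial y e
  binomial-cong e x≈y = 𝕊.+-congˡ (𝕊.-‿cong (monomial-cong e x≈y))

  binomial-⊛ : ∀ x e f i → (binomial x e ⊛ f) i ≈ f i - (monomial x e ⊛ f) i
  binomial-⊛ x e f i = trans (⊛-distribʳ f 𝕊.1# (𝕊.- monomial x e) i)
    (+-cong (⊛-identityˡ f i) (sym (at (𝕃.-‿distribˡ-* (monomial x e) f) i)))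

  binomial-⊛-≥ : ∀ x e f i → (binomial x e ⊛ f) (e ℕ.+ i) ≈ f (e ℕ.+ i) - x * f i
  binomial-⊛-≥ x e f i = trans (binomial-⊛ x e f (e ℕ.+ i)) (+-congˡ (-‿cong (monomial-⊛-≥ x e f i)))

  x-0≈x : ∀ x → x - 0# ≈ x
  x-0≈x x = trans (+-congˡ -0#≈0#) (+-identityʳ x)

  binomial-⊛-< : ∀ x {e} f {i} → i < e → (binomial x e ⊛ f) i ≈ f i
  binomial-⊛-< x {e} f {i} i<e = trans (binomial-⊛ x e f i)
    (trans (+-congˡ (-‿cong (monomial-⊛-< x f i<e))) (x-0≈x _))

  linear : Carrier → Series
  linear x = binomial x 1

  geometric : Carrier → Series
  geometric x i = x ^ i

  linear-⊛-geometric : ∀ x → linear x ⊛ geometric x ≋ 𝕊.1#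
  linear-⊛-geometric x = coeffwise go
    where
    go : ∀ i → (linear x ⊛ geometric x) i ≈ 𝕊.1# i
    go zero    = binomial-⊛-< x {1} (geometric x) (s≤s z≤n)
    go (suc i) = trans (binomial-⊛-≥ x 1 (geometric x) i) (-‿inverseʳ _)

  DegreeBelow : ℕ → Series → Set ℓ
  DegreeBelow d f = ∀ i → d ≤ i → f i ≈ 0#

  Polynomial : Series → Set ℓ
  Polynomial f = ∃ λ d → DegreeBelow d f

  -- The coefficient `t` may be zero, so that tops multiply without any hypothesis; nonvanishing is
  -- added separately in `NonzeroPolynomial`.
  HasTop : ℕ → Carrier → Series → Set ℓ
  HasTop d t f = f d ≈ t × DegreeBelow (suc d) f

  degreeZero-⊛ : ∀ {f} g n → DegreeBelow 1 f → (f ⊛ g) n ≈ f 0 * g n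
  degreeZero-⊛ {f} g n f<1 = trans (⊛-cong-at n f≈ (λ _ _ → refl)) (constant-⊛ (f 0) g n)
    where
    f≈ : ∀ i → i ≤ n → f i ≈ constant (f 0) i
    f≈ zero    _ = refl
    f≈ (suc i) _ = f<1 (suc i) (s≤s z≤n)

  degreeBelow-tail : ∀ {d f} → DegreeBelow (suc d) f → DegreeBelow d (f ∘ suc)
  degreeBelow-tail f<d i d≤i = f<d (suc i) (s≤s d≤i)

  -- The bounds are asymmetric, deg f ≤ d against deg g < e, so that they add up exactly and the
  -- induction can peel coefficients off `f` alone.
  ⊛-degreeBelow : ∀ d {e f g} → DegreeBelow (suc d) f → DegreeBelow e g → DegreeBelow (d ℕ.+ e) (f ⊛ g)
  ⊛-degreeBelow zero {g = g} f< g< i e≤i =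
    trans (degreeZero-⊛ g i f<) (trans (*-congˡ (g< i e≤i)) (zeroʳ _))
  ⊛-degreeBelow (suc d) {e} f< g< (suc i) (s≤s le) = trans (+-cong
    (trans (*-congˡ (g< (suc i) (ℕP.m≤n⇒m≤1+n (ℕP.≤-trans (ℕP.m≤n+m e d) le)))) (zeroʳ _))
    (⊛-degreeBelow d (degreeBelow-tail f<) g< i le)) (+-identityˡ _)

  ⊛-topCoefficient : ∀ d {e f g} → DegreeBelow (suc d) f → DegreeBelow (suc e) g →
    (f ⊛ g) (d ℕ.+ e) ≈ f d * g e
  ⊛-topCoefficient zero    {e} {g = g} f< g< = degreeZero-⊛ g e f<
  ⊛-topCoefficient (suc d) {e} f< g< = trans (+-cong
    (trans (*-congˡ (g< (suc (d ℕ.+ e)) (s≤s (ℕP.m≤n+m e d)))) (zeroʳ _))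
    (⊛-topCoefficient d (degreeBelow-tail f<) g<)) (+-identityˡ _)

  hasTop-cong : ∀ {d t f g} → f ≋ g → HasTop d t f → HasTop d t g
  hasTop-cong f≋g (top , f<) =
    trans (sym (at f≋g _)) top , λ i d<i → trans (sym (at f≋g i)) (f< i d<i)

  hasTop-⊛ : ∀ {d e t u f g} → HasTop d t f → HasTop e u g → HasTop (d ℕ.+ e) (t * u) (f ⊛ g)
  hasTop-⊛ {d} {e} (f-top , f<) (g-top , g<) =
    trans (⊛-topCoefficient d f< g<) (*-cong f-top g-top)
    , λ i lt → ⊛-degreeBelow d f< g< i (≡.subst (_≤ i) (≡.sym (ℕP.+-suc d e)) lt)

  hasTop-constant : ∀ x → HasTop 0 x (constant x)
  hasTop-constant x = refl , λ { (suc i) _ → refl }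

  hasTop-monomial : ∀ x e → HasTop e x (monomial x e)
  hasTop-monomial x e = monomial-diagonal x e , λ i e<i → monomial-offDiagonal x (ℕP.<⇒≢ e<i)

  hasTop-binomial : ∀ x {e} → 0 < e → HasTop e (- x) (binomial x e)
  hasTop-binomial x {suc e} 0<e =
    trans (+-congˡ (-‿cong (monomial-diagonal x (suc e)))) (+-identityˡ _)
    , λ { (suc i) e<i → trans (+-congˡ (-‿cong (monomial-offDiagonal x (ℕP.<⇒≢ e<i)))) (x-0≈x 0#) }

  hasTop-^ : ∀ {d t f} n → HasTop d t f → HasTop (n ℕ.* d) (t ^ n) (f 𝕃.^ n)
  hasTop-^ zero    top = hasTop-constant 1#
  hasTop-^ (suc n) top = hasTop-⊛ top (hasTop-^ n top)

  hasTop-prod : ∀ {k} (e : Fin k → ℕ) (t : Fin k → Carrier) {f : Fin k → Series} →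
    (∀ s → HasTop (e s) (t s) (f s)) → HasTop (sumℕ e) (prod k t) (𝕃.prod k f)
  hasTop-prod {zero}  e t top = hasTop-constant 1#
  hasTop-prod {suc k} e t top = hasTop-⊛ (top zero) (hasTop-prod (e ∘ suc) (t ∘ suc) (top ∘ suc))

  polynomial-cong : ∀ {f g} → f ≋ g → Polynomial f → Polynomial g
  polynomial-cong f≋g (d , f<) = d , λ i d≤i → trans (sym (at f≋g i)) (f< i d≤i)

  polynomial-⊕ : ∀ {f g} → Polynomial f → Polynomial g → Polynomial (f ⊕ g)
  polynomial-⊕ (d , f<) (e , g<) = d ℕ.⊔ e , λ i le →
    trans (+-cong (f< i (ℕP.m⊔n≤o⇒m≤o d e le)) (g< i (ℕP.m⊔n≤o⇒n≤o d e le))) (+-identityˡ 0#)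

  polynomial-⊛ : ∀ {f g} → Polynomial f → Polynomial g → Polynomial (f ⊛ g)
  polynomial-⊛ (d , f<) (e , g<) = d ℕ.+ e ,
    ⊛-degreeBelow d (λ i lt → f< i (ℕP.<⇒≤ lt)) g<

  polynomial-hasTop : ∀ {d t f} → HasTop d t f → Polynomial f
  polynomial-hasTop {d} (_ , f<) = suc d , f<

  polynomial-constant : ∀ x → Polynomial (constant x)
  polynomial-constant x = polynomial-hasTop (hasTop-constant x)

  polynomial-linear : ∀ x → Polynomial (linear x)
  polynomial-linear x = polynomial-hasTop (hasTop-binomial x (s≤s z≤n))

  polynomial-prod : ∀ n {f : Fin n → Series} → (∀ i → Polynomial (f i)) → Polynomial (𝕃.prod n f)
  polynomial-prod zero    p = polynomial-constant 1#
  polynomial-prod (suc n) p = polynomial-⊛ (p zero) (polynomial-prod n (p ∘ suc))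

  polynomial-^ : ∀ {f} n → Polynomial f → Polynomial (f 𝕃.^ n)
  polynomial-^ zero    p = polynomial-constant 1#
  polynomial-^ (suc n) p = polynomial-⊛ p (polynomial-^ n p)

  -- The substitution of x z for z. It sends 1 - y z to 1 - x y z.
  dilate : Carrier → Series → Series
  dilate x f i = x ^ i * f i

  dilate-⊛ : ∀ x f g → dilate x (f ⊛ g) ≋ dilate x f ⊛ dilate x g
  dilate-⊛ x f g = coeffwise (go f)
    where
    go : ∀ f n → dilate x (f ⊛ g) n ≈ (dilate x f ⊛ dilate x g) n
    go f zero    = solve 2 (λ a b → con 1 :* (a :* b) := (con 1 :* a) :* (con 1 :* b)) refl (f 0) (g 0)
    go f (suc n) = begin
      x ^ suc n * (f 0 * g (suc n) + ((f ∘ suc) ⊛ g) n)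
        ≈⟨ solve 5 (λ x y a b c → (x :* y) :* (a :* b :+ c)
             := (con 1 :* a) :* ((x :* y) :* b) :+ x :* (y :* c)) refl x (x ^ n) (f 0) (g (suc n)) _ ⟩
      1# * f 0 * (x ^ suc n * g (suc n)) + x * dilate x ((f ∘ suc) ⊛ g) n
        ≈⟨ +-congˡ (*-congˡ (go (f ∘ suc) n)) ⟩
      1# * f 0 * (x ^ suc n * g (suc n)) + x * (dilate x (f ∘ suc) ⊛ dilate x g) n
        ≈⟨ +-congˡ (⊛-scale x (dilate x (f ∘ suc)) (dilate x g) n) ⟨
      1# * f 0 * (x ^ suc n * g (suc n)) + ((λ i → x * dilate x (f ∘ suc) i) ⊛ dilate x g) n
        ≈⟨ +-congˡ (⊛-cong-at n (λ i _ → sym (*-assoc _ _ _)) (λ _ _ → refl)) ⟩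
      1# * f 0 * (x ^ suc n * g (suc n)) + ((dilate x f ∘ suc) ⊛ dilate x g) n
        ∎

  dilate-1 : ∀ x → dilate x 𝕊.1# ≋ 𝕊.1#
  dilate-1 x = coeffwise λ { zero → *-identityˡ _ ; (suc i) → zeroʳ _ }

  dilate-prod : ∀ x n (f : Fin n → Series) → dilate x (𝕃.prod n f) ≋ 𝕃.prod n (λ i → dilate x (f i))
  dilate-prod x zero    f = dilate-1 x
  dilate-prod x (suc n) f = 𝕊.trans (dilate-⊛ x (f zero) _) (𝕊.*-congˡ (dilate-prod x n (f ∘ suc)))

  dilate-linear : ∀ x y → dilate x (linear y) ≋ linear (x * y)
  dilate-linear x y = coeffwise λ
    { zero          → *-identityˡ _
    ; (suc zero)    → trans (*-cong (*-identityʳ x) (+-identityˡ _))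
                        (trans (sym (-‿distribʳ-* x y)) (sym (+-identityˡ _)))
    ; (suc (suc i)) → trans (*-congˡ (x-0≈x 0#)) (trans (zeroʳ _) (sym (x-0≈x 0#))) }

-- Products of linear factors and cancellation over a domain.

module PolynomialsOverDomain {c ℓ : Level} (R : CommutativeRing c ℓ) (dom : IsDomain R) where
  open CommutativeRing R hiding (zero)
  open RingLemmas R
  open DomainLemmas R dom
  open PowerSeries R
  open Polynomials R
  private module ≈R = Relation.Binary.Reasoning.Setoid setoid
  private module ≋R = Relation.Binary.Reasoning.Setoid 𝕊.setoid

  hasTop-unique : ∀ {d e t u f} → HasTop d t f → HasTop e u f → ¬ (t ≈ 0#) → ¬ (u ≈ 0#) →
    d ≡ e × t ≈ u
  hasTop-unique {d} {e} (t≈ , f<) (u≈ , f<′) t≉0 u≉0 with ℕP.<-cmp d e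
  ... | tri< d<e _ _    = contradiction (trans (sym u≈) (f< e d<e)) u≉0
  ... | tri≈ _ ≡.refl _ = ≡.refl , trans (sym t≈) u≈
  ... | tri> _ _ e<d    = contradiction (trans (sym t≈) (f<′ d e<d)) t≉0

  NonzeroPolynomial : Series → Set (c ⊔ ℓ)
  NonzeroPolynomial f = ∃ λ d → ∃ λ t → HasTop d t f × ¬ (t ≈ 0#)

  nonzeroPolynomial-⊛ : ∀ {f g} → NonzeroPolynomial f → NonzeroPolynomial g → NonzeroPolynomial (f ⊛ g)
  nonzeroPolynomial-⊛ (_ , _ , f-top , t≉0) (_ , _ , g-top , u≉0) =
    _ , _ , hasTop-⊛ f-top g-top , *-nonzero t≉0 u≉0

  nonzeroPolynomial-1 : NonzeroPolynomial 𝕊.1#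
  nonzeroPolynomial-1 = _ , _ , hasTop-constant 1# , 1≉0

  nonzeroPolynomial-prod : ∀ n {f : Fin n → Series} → (∀ i → NonzeroPolynomial (f i)) →
    NonzeroPolynomial (𝕃.prod n f)
  nonzeroPolynomial-prod zero    p = nonzeroPolynomial-1
  nonzeroPolynomial-prod (suc n) p = nonzeroPolynomial-⊛ (p zero) (nonzeroPolynomial-prod n (p ∘ suc))

  nonzeroPolynomial-^ : ∀ {f} n → NonzeroPolynomial f → NonzeroPolynomial (f 𝕃.^ n)
  nonzeroPolynomial-^ zero    p = nonzeroPolynomial-1
  nonzeroPolynomial-^ (suc n) p = nonzeroPolynomial-⊛ p (nonzeroPolynomial-^ n p)

  module _ (ξ ρ : Carrier) (e : ℕ) (ξ^d≈1 : ξ ^ suc e ≈ 1#)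
           (ξ^i≉1 : ∀ i → 0 < i → i < suc e → ¬ (ξ ^ i ≈ 1#)) where
    private
      d = suc e

      root : ℕ → Carrier
      root j = ξ ^ j * ρ

      factor : ℕ → Series
      factor j = linear (root j)

      P = 𝕃.prod d (factor ∘ toℕ)
      Q = 𝕃.prod e (factor ∘ suc ∘ toℕ)

      -- Dilation by ξ sends factor j to factor j + 1, and ξ^d = 1 identifies factor d with factor
      -- 0, so the factors are permuted cyclically.
      P-invariant : dilate ξ P ≋ P
      P-invariant = begin
        dilate ξ P
          ≈⟨ dilate-prod ξ d (factor ∘ toℕ) ⟩
        𝕃.prod d (λ j → dilate ξ (factor (toℕ j)))
          ≈⟨ 𝕃.prod-cong d (λ j → 𝕊.trans (dilate-linear ξ (root (toℕ j)))
               (binomial-cong 1 (sym (*-assoc ξ (ξ ^ toℕ j) ρ)))) ⟩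
        𝕃.prod d (factor ∘ suc ∘ toℕ)
          ≈⟨ 𝕃.prod-range-last e (factor ∘ suc) ⟩
        Q ⊛ factor d
          ≈⟨ 𝕊.*-congˡ (binomial-cong 1 (*-congʳ ξ^d≈1)) ⟩
        Q ⊛ factor 0
          ≈⟨ 𝕊.*-comm Q (factor 0) ⟩
        P ∎
        where open ≋R

      prod-constantTerm : ∀ n (y : Fin n → Carrier) → 𝕃.prod n (linear ∘ y) 0 ≈ 1#
      prod-constantTerm zero    y = refl
      prod-constantTerm (suc n) y =
        trans (*-cong (x-0≈x 1#) (prod-constantTerm n (y ∘ suc))) (*-identityˡ 1#)

      prod-degree : ∀ n (y : Fin n → Carrier) → DegreeBelow (suc n) (𝕃.prod n (linear ∘ y))
      prod-degree zero    y = proj₂ (hasTop-constant 1#)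
      prod-degree (suc n) y =
        ⊛-degreeBelow 1 (proj₂ (hasTop-binomial (y zero) (s≤s z≤n))) (prod-degree n (y ∘ suc))

      P-middle : ∀ i → 0 < i → i < d → P i ≈ 0#
      P-middle i 0<i i<d = *-zero-cancelˡ {ξ ^ i - 1#} (λ eq → ξ^i≉1 i 0<i i<d (x∙y⁻¹≈ε⇒x≈y _ _ eq))
        (begin
          (ξ ^ i - 1#) * P i          ≈⟨ distribʳ _ _ _ ⟩
          ξ ^ i * P i + - 1# * P i    ≈⟨ +-cong (at P-invariant i) (-1*x≈-x (P i)) ⟩
          P i - P i                   ≈⟨ -‿inverseʳ _ ⟩
          0#                          ∎)
        where open ≈R

      P-shape : P ≋ 𝕊.1# ⊕ monomial (P d) d
      P-shape = coeffwise go
        where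
        go : ∀ i → P i ≈ (𝕊.1# ⊕ monomial (P d) d) i
        go zero    = trans (prod-constantTerm d (root ∘ toℕ)) (sym (+-identityʳ _))
        go (suc i) with ℕP.<-cmp (suc i) d
        ... | tri< i<d i≢d _ = trans (P-middle (suc i) (s≤s z≤n) i<d)
          (sym (trans (+-identityˡ _) (monomial-offDiagonal _ (i≢d ∘ ≡.sym))))
        ... | tri≈ _ ≡.refl _ = sym (trans (+-identityˡ _) (monomial-diagonal _ d))
        ... | tri> _ i≢d d<i = trans (prod-degree d (root ∘ toℕ) (suc i) d<i)
          (sym (trans (+-identityˡ _) (monomial-offDiagonal _ (i≢d ∘ ≡.sym))))

      P/factor₀ : P ⊛ geometric ρ ≋ Q
      P/factor₀ = begin
        factor 0 ⊛ Q ⊛ geometric ρ   ≈⟨ 𝕊.*-congʳ (𝕊.*-congʳ (binomial-cong 1 (*-identityˡ ρ))) ⟩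
        linear ρ ⊛ Q ⊛ geometric ρ   ≈⟨ 𝕃.solve 3 (λ a b c → a 𝕃.:* b 𝕃.:* c 𝕃.:= (a 𝕃.:* c) 𝕃.:* b)
                                         𝕊.refl (linear ρ) Q (geometric ρ) ⟩
        linear ρ ⊛ geometric ρ ⊛ Q   ≈⟨ 𝕊.*-congʳ (linear-⊛-geometric ρ) ⟩
        𝕊.1# ⊛ Q                     ≈⟨ 𝕊.*-identityˡ Q ⟩
        Q                            ∎
        where open ≋R

      -- This replaces evaluation at 1/ρ and does not invert ρ. Multiplying by the geometric series
      -- of ρ removes factor 0 and leaves `Q`, of degree below d, whereas `P-shape` gives ρ^d + P d
      -- as coefficient d of the same product.
      P-top : P d ≈ - (ρ ^ d)
      P-top = x∙y⁻¹≈ε⇒x≈y _ _ (begin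
        P d - - (ρ ^ d)                           ≈⟨ +-cong (sym (*-identityʳ _)) (-‿involutive _) ⟩
        P d * 1# + ρ ^ d                          ≈⟨ +-comm _ _ ⟩
        ρ ^ d + P d * 1#
          ≈⟨ +-cong (⊛-identityˡ (geometric ρ) d)
               (≡.subst (λ j → (monomial (P d) d ⊛ geometric ρ) j ≈ P d * 1#) (ℕP.+-identityʳ d)
                 (monomial-⊛-≥ (P d) d (geometric ρ) 0)) ⟨
        (𝕊.1# ⊛ geometric ρ) d + (monomial (P d) d ⊛ geometric ρ) d
          ≈⟨ ⊛-distribʳ (geometric ρ) 𝕊.1# (monomial (P d) d) d ⟨
        ((𝕊.1# ⊕ monomial (P d) d) ⊛ geometric ρ) d ≈⟨ at (𝕊.*-congʳ P-shape) d ⟨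
        (P ⊛ geometric ρ) d                       ≈⟨ at P/factor₀ d ⟩
        Q d                                       ≈⟨ prod-degree e (root ∘ suc ∘ toℕ) d ℕP.≤-refl ⟩
        0#                                        ∎)
        where open ≈R

    -- The product is invariant under z ↦ ξ z, which kills all coefficients strictly
    -- between 0 and d; the top one is then determined by the root 1/ρ.
    prod-linear : 𝕃.prod d (λ j → linear (ξ ^ toℕ j * ρ)) ≋ binomial (ρ ^ d) d
    prod-linear = 𝕊.trans P-shape (𝕊.+-congˡ (𝕊.trans (monomial-cong d P-top)
      (coeffwise (monomial-neg (ρ ^ d) d))))
      where
      monomial-neg : ∀ x e i → monomial (- x) e i ≈ - monomial x e i
      monomial-neg x e i = trans (at (monomial-cong e (sym (-1*x≈-x x))) i)
        (trans (monomial-scale (- 1#) x e i) (-1*x≈-x _))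

  module Removal (ρ : Carrier) where

    -- h is prime to the linear factor 1 - ρ z, in the sense that h can be cancelled from
    -- the numerator of a fraction h g / (1 - ρ z) that is a polynomial.
    Removable : Series → Set (c ⊔ ℓ)
    Removable h = Polynomial h ×
      (∀ g → Polynomial g → Polynomial (geometric ρ ⊛ (h ⊛ g)) → Polynomial (geometric ρ ⊛ g))

    removable-cong : ∀ {h h′} → h ≋ h′ → Removable h → Removable h′
    removable-cong h≋h′ (p , rem) = polynomial-cong h≋h′ p ,
      λ g pg → rem g pg ∘ polynomial-cong (𝕊.*-congˡ (𝕊.*-congʳ (𝕊.sym h≋h′)))

    removable-1 : Removable 𝕊.1#
    removable-1 = polynomial-constant 1# , λ g _ → polynomial-cong (𝕊.*-congˡ (𝕊.*-identityˡ g))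

    -- First `h` is cancelled with `h′ ⊛ g` as remaining numerator, then `h′`. This is why
    -- removability quantifies over every polynomial `g`.
    removable-⊛ : ∀ {h h′} → Removable h → Removable h′ → Removable (h ⊛ h′)
    removable-⊛ {h} {h′} (p , rem) (p′ , rem′) = polynomial-⊛ p p′ , λ g pg r →
      rem′ g pg (rem (h′ ⊛ g) (polynomial-⊛ p′ pg) (polynomial-cong (𝕊.*-congˡ (𝕊.*-assoc h h′ g)) r))

    removable-^ : ∀ {h} n → Removable h → Removable (h 𝕃.^ n)
    removable-^ zero    r = removable-1
    removable-^ (suc n) r = removable-⊛ r (removable-^ n r)

    removable-prod : ∀ n {h : Fin n → Series} → (∀ i → Removable (h i)) → Removable (𝕃.prod n h)
    removable-prod zero    r = removable-1
    removable-prod (suc n) r = removable-⊛ (r zero) (removable-prod n (r ∘ suc))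

    -- Multiplying the identity by g / (1 - ρ z) expresses u g / (1 - ρ z) as p g plus v times the
    -- polynomial h g / (1 - ρ z). The nonzero constant u is then cancelled coefficient by
    -- coefficient.
    removable-bezout : ∀ {u p v h} → ¬ (u ≈ 0#) → Polynomial p → Polynomial v → Polynomial h →
      constant u ≋ p ⊛ linear ρ ⊕ v ⊛ h → Removable h
    removable-bezout {u} {p} {v} {h} u≉0 pp pv ph bez = ph , λ g pg r →
      let (d , below) = polynomial-cong (𝕊.sym (eq g)) (polynomial-⊕ (polynomial-⊛ pp pg) (polynomial-⊛ pv r))
      in d , λ i d≤i → *-zero-cancelˡ u≉0 (trans (sym (constant-⊛ u _ i)) (below i d≤i))
      where
      open ≋R
      q = geometric ρ
      eq : ∀ g → constant u ⊛ (q ⊛ g) ≋ p ⊛ g ⊕ v ⊛ (q ⊛ (h ⊛ g))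
      eq g = begin
        constant u ⊛ (q ⊛ g)                         ≈⟨ 𝕊.*-congʳ bez ⟩
        (p ⊛ linear ρ ⊕ v ⊛ h) ⊛ (q ⊛ g)
          ≈⟨ 𝕃.solve 6 (λ p l v h q g → (p 𝕃.:* l 𝕃.:+ v 𝕃.:* h) 𝕃.:* (q 𝕃.:* g)
               𝕃.:= p 𝕃.:* ((l 𝕃.:* q) 𝕃.:* g) 𝕃.:+ v 𝕃.:* (q 𝕃.:* (h 𝕃.:* g))) 𝕊.refl
               p (linear ρ) v h q g ⟩
        p ⊛ ((linear ρ ⊛ q) ⊛ g) ⊕ v ⊛ (q ⊛ (h ⊛ g))
          ≈⟨ 𝕊.+-congʳ (𝕊.*-congˡ (𝕊.trans (𝕊.*-congʳ (linear-⊛-geometric ρ)) (𝕊.*-identityˡ g))) ⟩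
        p ⊛ g ⊕ v ⊛ (q ⊛ (h ⊛ g))                    ∎

    removable-constant : ∀ {x} → ¬ (x ≈ 0#) → Removable (constant x)
    removable-constant {x} x≉0 = removable-bezout x≉0 (polynomial-constant 0#) (polynomial-constant 1#)
      (polynomial-constant x) (coeffwise λ i → sym
        (trans (+-cong (trans (constant-⊛ 0# _ i) (zeroˡ _)) (⊛-identityˡ _ i)) (+-identityˡ _)))

    -- The Bezout identity is 1 = (1 - ρ z) + ρ z.
    removable-z : Removable (monomial 1# 1)
    removable-z = removable-bezout {u = 1#} {p = 𝕊.1#} {v = constant ρ} 1≉0 (polynomial-constant 1#)
      (polynomial-constant ρ) (polynomial-hasTop (hasTop-monomial 1# 1))
      (coeffwise λ i → sym (trans (+-cong (⊛-identityˡ _ i) (constant-⊛ ρ _ i)) (go i)))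
      where
      go : ∀ i → linear ρ i + ρ * monomial 1# 1 i ≈ constant 1# i
      go zero          = trans (+-cong (x-0≈x 1#) (zeroʳ _)) (+-identityʳ _)
      go (suc zero)    = trans (+-cong (+-identityˡ _) (*-identityʳ _)) (-‿inverseˡ _)
      go (suc (suc i)) = trans (+-cong (x-0≈x 0#) (zeroʳ _)) (+-identityʳ _)

    removable-monomial : ∀ {x} e → ¬ (x ≈ 0#) → Removable (monomial x e)
    removable-monomial zero    x≉0 = removable-constant x≉0
    removable-monomial (suc e) x≉0 = removable-cong
      (𝕊.trans (monomial-⊛-monomial 1# 1 _ e) (monomial-cong (suc e) (*-identityˡ _)))
      (removable-⊛ removable-z (removable-monomial e x≉0))

    -- The Bezout identity is σ - ρ = σ (1 - ρ z) - ρ (1 - σ z).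
    removable-linear : ∀ {σ} → ¬ (σ ≈ ρ) → Removable (linear σ)
    removable-linear {σ} σ≉ρ = removable-bezout {u = σ - ρ} {p = constant σ} {v = constant (- ρ)}
      (σ≉ρ ∘ x∙y⁻¹≈ε⇒x≈y _ _) (polynomial-constant σ) (polynomial-constant (- ρ)) (polynomial-linear σ)
      (coeffwise λ i → sym (trans (+-cong (constant-⊛ σ _ i) (constant-⊛ (- ρ) _ i)) (go i)))
      where
      open ≈R
      go : ∀ i → σ * linear ρ i + - ρ * linear σ i ≈ constant (σ - ρ) i
      go zero          = +-cong (trans (*-congˡ (x-0≈x 1#)) (*-identityʳ _))
                                (trans (*-congˡ (x-0≈x 1#)) (*-identityʳ _))
      go (suc zero)    = begin
        σ * (0# - ρ) + - ρ * (0# - σ) ≈⟨ +-cong (*-congˡ (+-identityˡ _)) (*-congˡ (+-identityˡ _)) ⟩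
        σ * - ρ + - ρ * - σ           ≈⟨ +-cong (*-comm _ _) (sym (-‿distribʳ-* (- ρ) σ)) ⟩
        - ρ * σ - (- ρ * σ)           ≈⟨ -‿inverseʳ _ ⟩
        0#                            ∎
      go (suc (suc i)) = trans (+-cong (trans (*-congˡ (x-0≈x 0#)) (zeroʳ _))
                                       (trans (*-congˡ (x-0≈x 0#)) (zeroʳ _))) (+-identityʳ _)

    -- Cancelling `h` with g = 1 would make the geometric series of ρ a polynomial, but none of its
    -- coefficients ρ^i vanishes.
    removable-not-divisible : ¬ (ρ ≈ 0#) → ∀ {h} → Removable h → ¬ Polynomial (geometric ρ ⊛ h)
    removable-not-divisible ρ≉0 {h} (_ , rem) p =
      let (d , below) = polynomial-cong (𝕊.*-identityʳ (geometric ρ)) (rem 𝕊.1# (polynomial-constant 1#)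
                          (polynomial-cong (𝕊.*-congˡ (𝕊.sym (𝕊.*-identityʳ h))) p))
      in ^-nonzero d ρ≉0 (below d ℕP.≤-refl)

-- Finite sums over lists and tuples.

module ListSums {c ℓ : Level} (R : CommutativeRing c ℓ) where
  open CommutativeRing R hiding (zero)
  open RingLemmas R
  open Relation.Binary.Reasoning.Setoid setoid

  module _ {a} {A : Set a} where

    sumR-cong : ∀ {f g : A → Carrier} → (∀ x → f x ≈ g x) → ∀ xs → sumR R (map f xs) ≈ sumR R (map g xs)
    sumR-cong f≈g []       = refl
    sumR-cong f≈g (x ∷ xs) = +-cong (f≈g x) (sumR-cong f≈g xs)

    sumR-++ : ∀ (f : A → Carrier) xs ys → sumR R (map f (xs ++ ys)) ≈ sumR R (map f xs) + sumR R (map f ys)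
    sumR-++ f []       ys = sym (+-identityˡ _)
    sumR-++ f (x ∷ xs) ys = trans (+-congˡ (sumR-++ f xs ys)) (sym (+-assoc _ _ _))

    sumR-*ˡ : ∀ y (f : A → Carrier) xs → y * sumR R (map f xs) ≈ sumR R (map (λ x → y * f x) xs)
    sumR-*ˡ y f []       = zeroʳ y
    sumR-*ˡ y f (x ∷ xs) = trans (distribˡ _ _ _) (+-congˡ (sumR-*ˡ y f xs))

    sumR-*ʳ : ∀ y (f : A → Carrier) xs → sumR R (map f xs) * y ≈ sumR R (map (λ x → f x * y) xs)
    sumR-*ʳ y f []       = zeroˡ y
    sumR-*ʳ y f (x ∷ xs) = trans (distribʳ _ _ _) (+-congˡ (sumR-*ʳ y f xs))

    -- Trades a condition on the index for a summand that vanishes where the condition fails.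
    -- Coefficient extraction will be such a summand for the condition on the fractional part.
    sumR-filter : ∀ {p} {P : A → Set p} (P? : Decidable P) {f g : A → Carrier} →
      (∀ x → P x → f x ≈ g x) → (∀ x → ¬ P x → g x ≈ 0#) →
      ∀ xs → sumR R (map f (filter P? xs)) ≈ sumR R (map g xs)
    sumR-filter P? f≈g g≈0 []       = refl
    sumR-filter P? f≈g g≈0 (x ∷ xs) with P? x
    ... | yes px = +-cong (f≈g x px) (sumR-filter P? f≈g g≈0 xs)
    ... | no ¬px = trans (sumR-filter P? f≈g g≈0 xs) (sym (trans (+-congʳ (g≈0 x ¬px)) (+-identityˡ _)))

    sumR-zero : ∀ (xs : List A) → sumR R (map (λ _ → 0#) xs) ≈ 0#
    sumR-zero []       = refl
    sumR-zero (x ∷ xs) = trans (+-identityˡ _) (sumR-zero xs)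

    sumR-concatMap : ∀ {b} {B : Set b} (f : A → Carrier) (g : B → List A) xs →
      sumR R (map f (concatMap g xs)) ≈ sumR R (map (λ x → sumR R (map f (g x))) xs)
    sumR-concatMap f g []       = refl
    sumR-concatMap f g (x ∷ xs) = trans (sumR-++ f (g x) (concatMap g xs)) (+-congˡ (sumR-concatMap f g xs))

  -- Distributivity, by induction on k. Over R[[z]] it recognises the sum over a box of tuples as a
  -- product of k finite geometric sums.
  sumR-tuples : ∀ k (b : Fin k → ℕ) (w : Fin k → Carrier) →
    sumR R (map (λ ms → prod k (λ s → w s ^ ms s)) (tuples k b))
    ≈ prod k (λ s → sumR R (map (w s ^_) (range1 (b s))))
  sumR-tuples zero    b w = +-identityʳ 1#
  sumR-tuples (suc k) b w = begin
    sumR R (map monomials (concatMap (λ x → map (x VF.∷_) tails) (range1 (b zero))))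
      ≈⟨ sumR-concatMap monomials (λ x → map (x VF.∷_) tails) (range1 (b zero)) ⟩
    sumR R (map (λ x → sumR R (map monomials (map (x VF.∷_) tails))) (range1 (b zero)))
      ≈⟨ sumR-cong inner (range1 (b zero)) ⟩
    sumR R (map (λ x → w zero ^ x * rest) (range1 (b zero)))
      ≈⟨ sumR-*ʳ rest (w zero ^_) (range1 (b zero)) ⟨
    sumR R (map (w zero ^_) (range1 (b zero))) * rest
      ∎
    where
    monomials : (Fin (suc k) → ℕ) → Carrier
    monomials ms = prod (suc k) (λ s → w s ^ ms s)
    tails = tuples k (b ∘ suc)
    rest = prod k (λ s → sumR R (map (w (suc s) ^_) (range1 (b (suc s)))))
    inner : ∀ x → sumR R (map monomials (map (x VF.∷_) tails)) ≈ w zero ^ x * rest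
    inner x = begin
      sumR R (map monomials (map (x VF.∷_) tails))     ≡⟨ ≡.cong (sumR R) (map-∘ tails) ⟨
      sumR R (map (λ ms → w zero ^ x * prod k (λ s → w (suc s) ^ ms s)) tails)
        ≈⟨ sumR-*ˡ (w zero ^ x) (λ ms → prod k (λ s → w (suc s) ^ ms s)) tails ⟨
      w zero ^ x * sumR R (map (λ ms → prod k (λ s → w (suc s) ^ ms s)) tails)
        ≈⟨ *-congˡ (sumR-tuples k (b ∘ suc) (w ∘ suc)) ⟩
      w zero ^ x * rest ∎

  geometric-sum : ∀ w b → (1# - w) * sumR R (map (w ^_) (range1 b)) ≈ w * (1# - w ^ b)
  geometric-sum w b = begin
    (1# - w) * sumR R (map (w ^_) (range1 b))
      ≡⟨ ≡.cong (λ l → (1# - w) * sumR R l)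
           (≡.trans (≡.sym (map-∘ (upTo b))) (map-applyUpTo id (λ i → w ^ suc i) b)) ⟩
    (1# - w) * sumR R (applyUpTo (λ i → w * w ^ i) b)      ≈⟨ go w b ⟩
    w * (1# - w ^ b)                                       ∎
    where
    shift-cong : ∀ v b → sumR R (applyUpTo (λ i → v * w ^ suc i) b) ≈ sumR R (applyUpTo (λ i → v * w * w ^ i) b)
    shift-cong v b = go′ id b
      where
      -- `applyUpTo` recurses by composing with `suc`, so the induction needs an arbitrary index
      -- function `e`.
      go′ : ∀ (e : ℕ → ℕ) b → sumR R (applyUpTo (λ i → v * w ^ suc (e i)) b)
                            ≈ sumR R (applyUpTo (λ i → v * w * w ^ e i) b)
      go′ e zero    = refl
      go′ e (suc b) = +-cong (sym (*-assoc _ _ _)) (go′ (e ∘ suc) b)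
    -- The first term is generalised from `w` to `v`: peeling it off leaves the same kind of sum
    -- started at `v * w`.
    go : ∀ v b → (1# - w) * sumR R (applyUpTo (λ i → v * w ^ i) b) ≈ v * (1# - w ^ b)
    go v zero    = trans (zeroʳ _) (sym (trans (*-congˡ (-‿inverseʳ 1#)) (zeroʳ v)))
    go v (suc b) = begin
      (1# - w) * (v * 1# + sumR R (applyUpTo (λ i → v * w ^ suc i) b))
        ≈⟨ *-congˡ (+-congˡ (shift-cong v b)) ⟩
      (1# - w) * (v * 1# + sumR R (applyUpTo (λ i → v * w * w ^ i) b))
        ≈⟨ distribˡ _ _ _ ⟩
      (1# - w) * (v * 1#) + (1# - w) * sumR R (applyUpTo (λ i → v * w * w ^ i) b)
        ≈⟨ +-congˡ (go (v * w) b) ⟩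
      (1# - w) * (v * 1#) + v * w * (1# - w ^ b)
        ≈⟨ solve 4 (λ v w w′ p → (con 1 :+ w′) :* (v :* con 1) :+ v :* w :* (con 1 :+ p)
             := v :* ((con 1 :+ w :* p) :+ (w :+ w′))) refl v w (- w) (- (w ^ b)) ⟩
      v * ((1# + w * - (w ^ b)) + (w - w))
        ≈⟨ *-congˡ (trans (+-cong (+-congˡ (sym (-‿distribʳ-* w _))) (-‿inverseʳ w)) (+-identityʳ _)) ⟩
      v * (1# - w ^ suc b)
        ∎

-- Signs and signed binomial coefficients.

module Signs {c ℓ : Level} (R : CommutativeRing c ℓ) where
  open CommutativeRing R hiding (zero)
  open RingLemmas R
  open Relation.Binary.Reasoning.Setoid setoid

  sgn : ℕ → Carrier
  sgn n = (- 1#) ^ n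

  sgn-suc : ∀ n → sgn (suc n) ≈ - sgn n
  sgn-suc n = -1*x≈-x (sgn n)

  sgn-square : ∀ n → sgn n * sgn n ≈ 1#
  sgn-square = inverse-^ (trans (-1*x≈-x (- 1#)) (-‿involutive 1#))

  prod-neg : ∀ k (t : Fin k → Carrier) → prod k (λ s → - t s) ≈ sgn k * prod k t
  prod-neg zero    t = sym (*-identityˡ 1#)
  prod-neg (suc k) t = begin
    - t zero * prod k (λ s → - t (suc s))     ≈⟨ *-cong (sym (-1*x≈-x (t zero))) (prod-neg k (t ∘ suc)) ⟩
    - 1# * t zero * (sgn k * prod k (t ∘ suc))
      ≈⟨ solve 4 (λ a b c d → a :* b :* (c :* d) := a :* c :* (b :* d)) refl _ _ _ _ ⟩
    - 1# * sgn k * (t zero * prod k (t ∘ suc)) ∎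

  fromℤ-neg : ∀ i → fromℤ R (ℤ.- i) ≈ - fromℤ R i
  fromℤ-neg (+ zero)  = sym -0#≈0#
  fromℤ-neg (+ suc n) = refl
  fromℤ-neg -[1+ n ]  = sym (-‿involutive _)

  fromℤ-sgn : ∀ n → fromℤ R ((ℤ.- ℤ.1ℤ) ℤ.^ n) ≈ sgn n
  fromℤ-sgn zero    = +-identityʳ 1#
  fromℤ-sgn (suc n) = begin
    fromℤ R ((ℤ.- ℤ.1ℤ) ℤ.* (ℤ.- ℤ.1ℤ) ℤ.^ n) ≡⟨ ≡.cong (fromℤ R) (ℤP.-1*i≡-i ((ℤ.- ℤ.1ℤ) ℤ.^ n)) ⟩
    fromℤ R (ℤ.- ((ℤ.- ℤ.1ℤ) ℤ.^ n))          ≈⟨ fromℤ-neg ((ℤ.- ℤ.1ℤ) ℤ.^ n) ⟩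
    - fromℤ R ((ℤ.- ℤ.1ℤ) ℤ.^ n)              ≈⟨ -‿cong (fromℤ-sgn n) ⟩
    - sgn n                                   ≈⟨ sgn-suc n ⟨
    sgn (suc n)                               ∎

  fromℕ-+ : ∀ m n → fromℕ R (m ℕ.+ n) ≈ fromℕ R m + fromℕ R n
  fromℕ-+ zero    n = sym (+-identityˡ _)
  fromℕ-+ (suc m) n = trans (+-congˡ (fromℕ-+ m n)) (sym (+-assoc _ _ _))

  nC0≡1 : ∀ n → n C 0 ≡ 1
  nC0≡1 n = ≡.trans (nCk≡nC[n∸k] {0} {n} z≤n) (nCn≡1 n)

  -- The coefficient of y^j in y^f (1 - y)^n.
  signedC : ℕ → ℕ → ℕ → Carrier
  signedC n zero    j       = sgn j * fromℕ R (n C j)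
  signedC n (suc f) zero    = 0#
  signedC n (suc f) (suc j) = signedC n f j

  signedC-0 : ∀ n f → signedC (suc n) f 0 ≈ signedC n f 0
  signedC-0 n zero    = *-congˡ (reflexive (≡.cong (fromℕ R) (≡.trans (nC0≡1 (suc n)) (≡.sym (nC0≡1 n)))))
  signedC-0 n (suc f) = refl

  -- This is multiplication of y^f (1 - y)^n by 1 - y; for f = 0 it is Pascal's rule.
  signedC-pascal : ∀ n f j → signedC (suc n) f (suc j) ≈ signedC n f (suc j) - signedC n f j
  signedC-pascal n zero j = begin
    sgn (suc j) * fromℕ R (suc n C suc j)
      ≡⟨ ≡.cong (λ b → sgn (suc j) * fromℕ R b) (nCk+nC[k+1]≡[n+1]C[k+1] n j) ⟨
    sgn (suc j) * fromℕ R (n C j ℕ.+ n C suc j)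
      ≈⟨ *-congˡ (trans (fromℕ-+ (n C j) (n C suc j)) (+-comm _ _)) ⟩
    sgn (suc j) * (fromℕ R (n C suc j) + fromℕ R (n C j))
      ≈⟨ distribˡ _ _ _ ⟩
    sgn (suc j) * fromℕ R (n C suc j) + sgn (suc j) * fromℕ R (n C j)
      ≈⟨ +-congˡ (trans (*-congʳ (sgn-suc j)) (sym (-‿distribˡ-* _ _))) ⟩
    sgn (suc j) * fromℕ R (n C suc j) - sgn j * fromℕ R (n C j)
      ∎
  signedC-pascal n (suc f) zero    = trans (signedC-0 n f) (sym (trans (+-congˡ -0#≈0#) (+-identityʳ _)))
  signedC-pascal n (suc f) (suc j) = signedC-pascal n f j

  signedC-≤ : ∀ n {f j} → f ≤ j → signedC n f j ≈ sgn (j ℕ.∸ f) * fromℕ R (n C (j ℕ.∸ f))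
  signedC-≤ n {zero}  z≤n       = refl
  signedC-≤ n {suc f} (s≤s f≤j) = signedC-≤ n f≤j

  signedC-> : ∀ n {f j} → j < f → signedC n f j ≈ 0#
  signedC-> n {suc f} {zero}  _         = refl
  signedC-> n {suc f} {suc j} (s≤s j<f) = signedC-> n j<f

  -- By the symmetry of binomial coefficients, (-1)^n (-1)^f C(n, f) = (-1)^(n - f) C(n, n - f) for
  -- f ≤ n, and both sides vanish for f > n. So a term of `S` with integer part f becomes, after
  -- multiplication by (-1)^n, a coefficient of y^n; this is why `S` is found at z^(A + n N).
  signedC-diagonal : ∀ n f → sgn n * (sgn f * fromℕ R (n C f)) ≈ signedC n f n
  signedC-diagonal n f with f ℕP.≤? n
  ... | no f≰n = trans (*-congˡ (trans (*-congˡ (reflexive (≡.cong (fromℕ R) (k>n⇒nCk≡0 (ℕP.≰⇒> f≰n))))) (zeroʳ _)))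
    (trans (zeroʳ _) (sym (signedC-> n (ℕP.≰⇒> f≰n))))
  ... | yes f≤n = begin
    sgn n * (sgn f * fromℕ R (n C f))
      ≈⟨ *-congʳ (trans (^-congʳ (- 1#) (≡.sym (ℕP.m∸n+n≡m f≤n))) (^-+ (- 1#) (n ℕ.∸ f) f)) ⟩
    sgn (n ℕ.∸ f) * sgn f * (sgn f * fromℕ R (n C f))
      ≈⟨ solve 3 (λ a b c → a :* b :* (b :* c) := b :* b :* (a :* c)) refl _ _ _ ⟩
    sgn f * sgn f * (sgn (n ℕ.∸ f) * fromℕ R (n C f))
      ≈⟨ trans (*-congʳ (sgn-square f)) (*-identityˡ _) ⟩
    sgn (n ℕ.∸ f) * fromℕ R (n C f)
      ≡⟨ ≡.cong (λ b → sgn (n ℕ.∸ f) * fromℕ R b) (nCk≡nC[n∸k] f≤n) ⟩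
    sgn (n ℕ.∸ f) * fromℕ R (n C (n ℕ.∸ f))
      ≈⟨ signedC-≤ n f≤n ⟨
    signedC n f n ∎

-- Coefficients along residue classes modulo N.

module Sections {c ℓ : Level} (R : CommutativeRing c ℓ) (N : ℕ) .{{_ : NonZero N}} where
  open CommutativeRing R hiding (zero)
  open RingLemmas R
  open PowerSeries R
  open Polynomials R
  open Signs R
  open Relation.Binary.Reasoning.Setoid setoid

  index-suc : ∀ A j → A ℕ.+ suc j ℕ.* N ≡ N ℕ.+ (A ℕ.+ j ℕ.* N)
  index-suc A j = ≡.trans (≡.sym (ℕP.+-assoc A N (j ℕ.* N)))
    (≡.trans (≡.cong (ℕ._+ j ℕ.* N) (ℕP.+-comm A N)) (ℕP.+-assoc N A (j ℕ.* N)))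

  index-< : ∀ {A} j {n} → A < N → j ≤ n → A ℕ.+ j ℕ.* N < suc n ℕ.* N
  index-< j A<N j≤n = ℕP.+-mono-<-≤ A<N (ℕP.*-monoˡ-≤ N j≤n)

  module _ (f : Series) {A} (A<N : A < N) where

    binomial-section-0 : (binomial 1# N ⊛ f) (A ℕ.+ 0) ≈ f (A ℕ.+ 0)
    binomial-section-0 = binomial-⊛-< 1# f (≡.subst (_< N) (≡.sym (ℕP.+-identityʳ A)) A<N)

    binomial-section-suc : ∀ j → (binomial 1# N ⊛ f) (A ℕ.+ suc j ℕ.* N) ≈ f (A ℕ.+ suc j ℕ.* N) - f (A ℕ.+ j ℕ.* N)
    binomial-section-suc j rewrite index-suc A j =
      trans (binomial-⊛-≥ 1# N f (A ℕ.+ j ℕ.* N)) (+-congˡ (-‿cong (*-identityˡ _)))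

  -- Along the indices A + j N, multiplication by 1 - z^N acts as multiplication by 1 - y with y =
  -- z^N. Since `signedC 0 f j` is the indicator of j = f, the hypothesis says that `g` restricts to
  -- x y^f; n factors turn this into x y^f (1 - y)^n.
  binomialPower-section : ∀ f {A g x} → A < N → (∀ j → g (A ℕ.+ j ℕ.* N) ≈ signedC 0 f j * x) →
    ∀ n j → (binomial 1# N 𝕃.^ n ⊛ g) (A ℕ.+ j ℕ.* N) ≈ signedC n f j * x
  binomialPower-section f {g = g} A<N base zero j = trans (⊛-identityˡ g _) (base j)
  binomialPower-section f {A} {g} {x} A<N base (suc n) zero = begin
    (b ⊛ b 𝕃.^ n ⊛ g) (A ℕ.+ 0)       ≈⟨ ⊛-assoc b (b 𝕃.^ n) g (A ℕ.+ 0) ⟩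
    (b ⊛ (b 𝕃.^ n ⊛ g)) (A ℕ.+ 0)     ≈⟨ binomial-section-0 (b 𝕃.^ n ⊛ g) A<N ⟩
    (b 𝕃.^ n ⊛ g) (A ℕ.+ 0)           ≈⟨ binomialPower-section f A<N base n 0 ⟩
    signedC n f 0 * x                 ≈⟨ *-congʳ (signedC-0 n f) ⟨
    signedC (suc n) f 0 * x           ∎
    where b = binomial 1# N
  binomialPower-section f {A} {g} {x} A<N base (suc n) (suc j) = begin
    (b ⊛ b 𝕃.^ n ⊛ g) (A ℕ.+ suc j ℕ.* N)       ≈⟨ ⊛-assoc b (b 𝕃.^ n) g (A ℕ.+ suc j ℕ.* N) ⟩
    (b ⊛ (b 𝕃.^ n ⊛ g)) (A ℕ.+ suc j ℕ.* N)     ≈⟨ binomial-section-suc (b 𝕃.^ n ⊛ g) A<N j ⟩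
    (b 𝕃.^ n ⊛ g) (A ℕ.+ suc j ℕ.* N) - (b 𝕃.^ n ⊛ g) (A ℕ.+ j ℕ.* N)
      ≈⟨ +-cong (binomialPower-section f A<N base n (suc j)) (-‿cong (binomialPower-section f A<N base n j)) ⟩
    signedC n f (suc j) * x - signedC n f j * x   ≈⟨ +-congˡ (-‿distribˡ-* _ _) ⟩
    signedC n f (suc j) * x + - signedC n f j * x ≈⟨ distribʳ _ _ _ ⟨
    (signedC n f (suc j) - signedC n f j) * x     ≈⟨ *-congʳ (signedC-pascal n f j) ⟨
    signedC (suc n) f (suc j) * x                 ∎
    where b = binomial 1# N

  signedC-0-0 : ∀ x → signedC 0 0 0 * x ≈ x
  signedC-0-0 x = trans (*-congʳ (trans (*-identityˡ _) (+-identityʳ 1#))) (*-identityˡ x)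

  signedC-0-suc : ∀ j x → signedC 0 0 (suc j) * x ≈ 0#
  signedC-0-suc j x = trans (*-congʳ (trans (*-congˡ (reflexive (≡.cong (fromℕ R) (k>n⇒nCk≡0 {0} {suc j} (s≤s z≤n)))))
    (zeroʳ _))) (zeroˡ x)

  -- With A and B below N, the two exponents agree exactly when A = B and j = f. The first condition
  -- is carried by the factor `monomial x B A`, the second by `signedC 0 f j`.
  monomial-section : ∀ x {A B} → A < N → B < N → ∀ f j →
    monomial x (B ℕ.+ f ℕ.* N) (A ℕ.+ j ℕ.* N) ≈ signedC 0 f j * monomial x B A
  monomial-section x {A} {B} A<N B<N zero zero rewrite ℕP.+-identityʳ A | ℕP.+-identityʳ B =
    sym (signedC-0-0 _)
  monomial-section x {A} {B} A<N B<N zero (suc j) = trans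
    (monomial-offDiagonal x (ℕP.<⇒≢ (≡.subst₂ _<_ (≡.sym (ℕP.+-identityʳ B)) (≡.sym (index-suc A j))
      (ℕP.<-≤-trans B<N (ℕP.m≤m+n N _)))))
    (sym (signedC-0-suc j _))
  monomial-section x {A} {B} A<N B<N (suc f) zero = trans
    (monomial-offDiagonal x (ℕP.>⇒≢ (≡.subst₂ _<_ (≡.sym (ℕP.+-identityʳ A)) (≡.sym (index-suc B f))
      (ℕP.<-≤-trans A<N (ℕP.m≤m+n N _)))))
    (sym (zeroˡ _))
  monomial-section x {A} {B} A<N B<N (suc f) (suc j) rewrite index-suc A j | index-suc B f =
    trans (monomial-+ x N _ _) (monomial-section x A<N B<N f j)

  binomialPower-⊛-monomial : ∀ x W {A} → A < N → ∀ n →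
    (binomial 1# N 𝕃.^ n ⊛ monomial x W) (A ℕ.+ n ℕ.* N) ≈ signedC n (W ℕ./ N) n * monomial x (W ℕ.% N) A
  binomialPower-⊛-monomial x W {A} A<N n = binomialPower-section (W ℕ./ N) {g = monomial x W} A<N
    (λ j → trans (reflexive (≡.cong (λ v → monomial x v (A ℕ.+ j ℕ.* N)) (ℕDM.m≡m%n+[m/n]*n W N)))
      (monomial-section x A<N (ℕDM.m%n<n W N) (W ℕ./ N) j)) n n

-- Roots of unity, covering multiplicities and the generating series.

module Covering {c ℓ : Level} (R : CommutativeRing c ℓ) (dom : IsDomain R)
  {k : ℕ} (a : Fin k → ℤ) (ns : Fin k → ℕ) (pos : ∀ s → NonZero (ns s))
  (ζ : CommutativeRing.Carrier R) (primitive-ζ : IsPrimitiveRoot R ζ (prodℕ ns)) where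

  open CommutativeRing R hiding (zero)
  open RingLemmas R
  open DomainLemmas R dom
  open PowerSeries R
  open Polynomials R
  open PolynomialsOverDomain R dom
  open Signs R
  private
    module 𝕊Sums = ListSums seriesRing
    module RSums = ListSums R
    module ≈R = Relation.Binary.Reasoning.Setoid setoid
    module ≋R = Relation.Binary.Reasoning.Setoid 𝕊.setoid

  N : ℕ
  N = prodℕ ns

  instance
    N≢0 : NonZero N
    N≢0 = prodℕ-nonZero ns pos

  open Sections R N

  ζ^N≈1 : ζ ^ N ≈ 1#
  ζ^N≈1 = proj₁ primitive-ζ

  ζ^-mod : ∀ v → ζ ^ (v ℕ.% N) ≈ ζ ^ v
  ζ^-mod v = sym (begin
    ζ ^ v                               ≈⟨ ^-congʳ ζ (ℕDM.m≡m%n+[m/n]*n v N) ⟩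
    ζ ^ (v ℕ.% N ℕ.+ v ℕ./ N ℕ.* N)     ≈⟨ ^-+ ζ (v ℕ.% N) _ ⟩
    ζ ^ (v ℕ.% N) * ζ ^ (v ℕ./ N ℕ.* N)
      ≈⟨ *-congˡ (trans (^-* ζ (v ℕ./ N) N) (trans (^-congˡ (v ℕ./ N) ζ^N≈1) (1^ (v ℕ./ N)))) ⟩
    ζ ^ (v ℕ.% N) * 1#                  ≈⟨ *-identityʳ _ ⟩
    ζ ^ (v ℕ.% N)                       ∎)
    where open ≈R

  ζ≉0 : ¬ (ζ ≈ 0#)
  ζ≉0 ζ≈0 = 1≉0 (trans (sym ζ^N≈1) (^-zero N))
    where
    ^-zero : ∀ n .{{_ : NonZero n}} → ζ ^ n ≈ 0#
    ^-zero (suc n) = trans (*-congʳ ζ≈0) (zeroˡ _)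

  ζ^≉0 : ∀ n → ¬ (ζ ^ n ≈ 0#)
  ζ^≉0 n = ^-nonzero n ζ≉0

  ζ^-distinct-< : ∀ {x y} → x < y → y < N → ¬ (ζ ^ x ≈ ζ ^ y)
  ζ^-distinct-< {x} {y} x<y y<N eq = proj₂ primitive-ζ (y ℕ.∸ x) (ℕP.m<n⇒0<n∸m x<y)
    (ℕP.≤-<-trans (ℕP.m∸n≤m y x) y<N)
    (*-cancelˡ-nonzero (ζ^≉0 x) (begin
      ζ ^ x * ζ ^ (y ℕ.∸ x)   ≈⟨ ^-+ ζ x (y ℕ.∸ x) ⟨
      ζ ^ (x ℕ.+ (y ℕ.∸ x))   ≈⟨ ^-congʳ ζ (ℕP.m+[n∸m]≡n (ℕP.<⇒≤ x<y)) ⟩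
      ζ ^ y                   ≈⟨ eq ⟨
      ζ ^ x                   ≈⟨ *-identityʳ _ ⟨
      ζ ^ x * 1#              ∎))
    where open ≈R

  ζ^-distinct : ∀ {x y} → x < N → y < N → x ≢ y → ¬ (ζ ^ x ≈ ζ ^ y)
  ζ^-distinct {x} {y} x<N y<N x≢y eq with ℕP.<-cmp x y
  ... | tri< x<y _ _ = ζ^-distinct-< x<y y<N eq
  ... | tri≈ _ x≡y _ = x≢y x≡y
  ... | tri> _ _ y<x = ζ^-distinct-< y<x x<N (sym eq)

  residue : Fin k → ℕ
  residue s = _%ℕ_ (a s) (ns s) {{pos s}}

  residue-< : ∀ s → residue s < ns s
  residue-< s = n%ℕd<d (a s) (ns s) {{pos s}}

  cofactor>0 : ∀ s → 0 < cofactor ns s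
  cofactor>0 s = ℕP.n≢0⇒n>0 λ eq →
    ℕ.≢-nonZero⁻¹ N (≡.trans (≡.sym (cofactor-* ns s)) (≡.cong (ℕ._* ns s) eq))

  w-coefficient : Fin k → Carrier
  w-coefficient s = ζ ^ (residue s ℕ.* cofactor ns s)

  w : Fin k → Series
  w s = monomial (w-coefficient s) (cofactor ns s)

  1-w : Fin k → Series
  1-w s = binomial (w-coefficient s) (cofactor ns s)

  1-z^N : Series
  1-z^N = binomial 1# N

  root root⁻¹ : ℕ → Series
  root y = linear (ζ ^ y)
  root⁻¹ y = geometric (ζ ^ y)

  root-inverse : ∀ y → root y ⊛ root⁻¹ y ≋ 𝕊.1#
  root-inverse y = linear-⊛-geometric (ζ ^ y)

  -- Factors outside the class are 1 instead of being omitted, so that every product runs over 0 ≤ y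
  -- < N and the products over s and y can be interchanged. `f` is a parameter because both `root`
  -- and `root⁻¹` occur.
  covers : Fin k → (ℕ → Series) → ℕ → Series
  covers s f y = if does (congDec (+ y) (a s) (ns s)) then f y else 𝕊.1#

  multiplicity : ℕ → ℕ
  multiplicity y = coverCount a ns (+ y)

  -- If N = d n then ζ^n is a primitive d-th root of unity, so `prod-linear` applies. The successor
  -- form of `d` enters as an equation because `d` will be a computed number such as
  -- `cofactor ns s`.
  prod-roots : ∀ n ρ d {e} → N ≡ d ℕ.* n → d ≡ suc e →
    𝕃.prod d (λ j → linear (ζ ^ (toℕ j ℕ.* n) * ρ)) ≋ binomial (ρ ^ d) d
  prod-roots n ρ d {e} N≡dn ≡.refl = 𝕊.trans
    (𝕃.prod-cong d (λ j → binomial-cong 1 (*-congʳ {ρ} (^-* ζ (toℕ j) n))))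
    (prod-linear (ζ ^ n) ρ e
      (trans (sym (^-* ζ d n)) (trans (^-congʳ ζ (≡.sym N≡dn)) ζ^N≈1))
      (λ i 0<i i<d eq → proj₂ primitive-ζ (i ℕ.* n) (ℕP.*-mono-≤ 0<i n>0)
        (≡.subst (i ℕ.* n <_) (≡.sym N≡dn) (ℕP.*-monoˡ-< n {{ℕ.>-nonZero n>0}} i<d))
        (trans (^-* ζ i n) eq)))
    where
    n>0 : 0 < n
    n>0 = ℕP.n≢0⇒n>0 λ { ≡.refl → ℕ.≢-nonZero⁻¹ N (≡.trans N≡dn (ℕP.*-zeroʳ d)) }

  factor-1-z^N : 1-z^N ≋ 𝕃.prod N (root ∘ toℕ)
  factor-1-z^N = 𝕊.sym (begin
    𝕃.prod N (root ∘ toℕ)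
      ≈⟨ 𝕃.prod-cong N (λ j → binomial-cong 1 (trans (^-congʳ ζ (≡.sym (ℕP.*-identityʳ (toℕ j)))) (sym (*-identityʳ _)))) ⟩
    𝕃.prod N (λ j → linear (ζ ^ (toℕ j ℕ.* 1) * 1#))
      ≈⟨ prod-roots 1 1# N (≡.sym (ℕP.*-identityʳ N)) (≡.sym (ℕP.suc-pred N)) ⟩
    binomial (1# ^ N) N
      ≈⟨ binomial-cong N (1^ N) ⟩
    1-z^N ∎)
    where open ≋R

  -- Each block of n_s consecutive integers contains exactly one member of the class, at offset
  -- `residue s`.
  covers-range : ∀ s f j → 𝕃.prod (ns s) (λ r → covers s f (toℕ j ℕ.* ns s ℕ.+ toℕ r))
    ≋ f (toℕ {cofactor ns s} j ℕ.* ns s ℕ.+ residue s)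
  covers-range s f j = 𝕊.trans (𝕃.prod-single r₀ (λ r → covers s f (x r)) other) (𝕊.reflexive at-r₀)
    where
    r₀ = fromℕ< (residue-< s)
    x : Fin (ns s) → ℕ
    x r = toℕ j ℕ.* ns s ℕ.+ toℕ r
    other : ∀ r → r ≢ r₀ → covers s f (x r) ≋ 𝕊.1#
    other r r≢r₀ with congDec (+ x r) (a s) (ns s)
    ... | no  _   = 𝕊.refl
    ... | yes x≡a = contradiction (FinP.toℕ-injective (≡.trans
      (congruent⇒residue (a s) (ns s) {{pos s}} (toℕ j) (toℕ r) (FinP.toℕ<n r) x≡a)
      (≡.sym (FinP.toℕ-fromℕ< (residue-< s))))) r≢r₀
    at-r₀ : covers s f (x r₀) ≡ f (toℕ j ℕ.* ns s ℕ.+ residue s)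
    at-r₀ with congDec (+ x r₀) (a s) (ns s)
    ... | yes _   = ≡.cong (λ r → f (toℕ j ℕ.* ns s ℕ.+ r)) (FinP.toℕ-fromℕ< (residue-< s))
    ... | no  x≢a = contradiction (residue⇒congruent (a s) (ns s) {{pos s}} (toℕ j) (toℕ r₀)
      (FinP.toℕ<n r₀) (FinP.toℕ-fromℕ< (residue-< s))) x≢a

  -- Once the blocks are collapsed, the factors are 1 - ζ^(j n_s) ρ z with ρ = ζ^(residue s) and 0 ≤
  -- j < N / n_s, which is the situation of `prod-roots`.
  factor-1-w : ∀ s → 1-w s ≋ 𝕃.prod N (covers s root ∘ toℕ)
  factor-1-w s = 𝕊.sym (begin
    𝕃.prod N (covers s root ∘ toℕ)
      ≡⟨ ≡.cong (λ n → 𝕃.prod n (covers s root ∘ toℕ)) (cofactor-* ns s) ⟨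
    𝕃.prod (d ℕ.* ns s) (covers s root ∘ toℕ)
      ≈⟨ 𝕃.prod-range-* d (ns s) (covers s root) ⟩
    𝕃.prod d (λ j → 𝕃.prod (ns s) (λ r → covers s root (toℕ j ℕ.* ns s ℕ.+ toℕ r)))
      ≈⟨ 𝕃.prod-cong d (covers-range s root) ⟩
    𝕃.prod d (λ j → root (toℕ j ℕ.* ns s ℕ.+ residue s))
      ≈⟨ 𝕃.prod-cong d (λ j → binomial-cong 1 (^-+ ζ (toℕ j ℕ.* ns s) (residue s))) ⟩
    𝕃.prod d (λ j → linear (ζ ^ (toℕ j ℕ.* ns s) * ζ ^ residue s))
      ≈⟨ prod-roots (ns s) (ζ ^ residue s) d (≡.sym (cofactor-* ns s))
           (≡.sym (ℕP.suc-pred d {{ℕ.>-nonZero (cofactor>0 s)}})) ⟩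
    binomial ((ζ ^ residue s) ^ d) d
      ≈⟨ binomial-cong d (trans (sym (^-* ζ d (residue s))) (^-congʳ ζ (ℕP.*-comm d (residue s)))) ⟩
    1-w s ∎)
    where
    open ≋R
    d = cofactor ns s

  -- Assembled from inverses of linear factors, not as a sum of powers of `w s`, so that
  -- interchanging products exposes the multiplicities.
  1/[1-w] : Fin k → Series
  1/[1-w] s = 𝕃.prod N (covers s root⁻¹ ∘ toℕ)

  1-w-inverse : ∀ s → 1-w s ⊛ 1/[1-w] s ≋ 𝕊.1#
  1-w-inverse s = 𝕊.trans (𝕊.*-congʳ (factor-1-w s)) (𝕊.trans
    (𝕊.sym (𝕃.prod-distrib-* N (covers s root ∘ toℕ) (covers s root⁻¹ ∘ toℕ)))
    (𝕃.prod-trivial N (λ y → pointwise (toℕ y))))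
    where
    pointwise : ∀ y → covers s root y ⊛ covers s root⁻¹ y ≋ 𝕊.1#
    pointwise y with does (congDec (+ y) (a s) (ns s))
    ... | true  = root-inverse y
    ... | false = 𝕊.*-identityˡ 𝕊.1#

  prod-1/[1-w] : 𝕃.prod k 1/[1-w] ≋ 𝕃.prod N (λ y → root⁻¹ (toℕ y) 𝕃.^ multiplicity (toℕ y))
  prod-1/[1-w] = 𝕊.trans (𝕃.prod-comm k N (λ s y → covers s root⁻¹ (toℕ y)))
    (𝕃.prod-cong N (λ y → 𝕃.prod-filter (λ s → congDec (+ toℕ y) (a s) (ns s)) (root⁻¹ (toℕ y)) id))

  -- Up to sign, S(n, A/N) is the coefficient of z^{A + nN} of this series.
  generating : ℕ → Series
  generating n = 𝕃.prod k w ⊛ (1-z^N 𝕃.^ n ⊛ 𝕃.prod k 1/[1-w])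

  prod-monomials : ∀ {k} (u v : Fin k → ℕ) →
    𝕃.prod k (λ s → monomial (ζ ^ u s) (v s)) ≋ monomial (ζ ^ sumℕ u) (sumℕ v)
  prod-monomials {zero}  u v = 𝕊.refl
  prod-monomials {suc k} u v = 𝕊.trans (𝕊.*-congˡ (prod-monomials (u ∘ suc) (v ∘ suc))) (𝕊.trans
    (monomial-⊛-monomial (ζ ^ u zero) (v zero) (ζ ^ sumℕ (u ∘ suc)) (sumℕ (v ∘ suc)))
    (monomial-cong (sumℕ v) (sym (^-+ ζ (u zero) (sumℕ (u ∘ suc))))))

  module _ (ms : Fin k → ℕ) where
    open WeightedSums ns pos ms

    prod-w^ : 𝕃.prod k (λ s → w s 𝕃.^ ms s) ≋ monomial (ζ ^ weight residue) (weight (λ _ → 1))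
    prod-w^ = 𝕊.trans (𝕃.prod-cong k factor)
      (prod-monomials (λ s → residue s ℕ.* ms s ℕ.* cofactor ns s) (λ s → 1 ℕ.* ms s ℕ.* cofactor ns s))
      where
      exponent : ∀ m r c → m ℕ.* (r ℕ.* c) ≡ r ℕ.* m ℕ.* c
      exponent = ℕSolver.solve-∀
      factor : ∀ s → w s 𝕃.^ ms s
        ≋ monomial (ζ ^ (residue s ℕ.* ms s ℕ.* cofactor ns s)) (1 ℕ.* ms s ℕ.* cofactor ns s)
      factor s = 𝕊.trans (monomial-^ (w-coefficient s) (cofactor ns s) (ms s)) (𝕊.trans
        (𝕊.reflexive (≡.cong (λ m → monomial (w-coefficient s ^ ms s) (m ℕ.* cofactor ns s))
          (≡.sym (ℕP.*-identityˡ (ms s)))))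
        (monomial-cong (1 ℕ.* ms s ℕ.* cofactor ns s) (trans (sym (^-* ζ (ms s) (residue s ℕ.* cofactor ns s)))
          (^-congʳ ζ (exponent (ms s) (residue s) (cofactor ns s))))))

    T : ℚ
    T = wsum ns pos (λ _ → + 1) ms

    summand : ℕ → Carrier
    summand n = fromℤ R ((ℤ.- ℤ.1ℤ) ℤ.^ ℤ.∣ floor T ∣)
      * (fromℕ R (n C ℤ.∣ floor T ∣) * expζ R ζ N (wsum ns pos a ms))

    coefficient-prod-w^ : ∀ n {A} → A < N →
      (1-z^N 𝕃.^ n ⊛ 𝕃.prod k (λ s → w s 𝕃.^ ms s)) (A ℕ.+ n ℕ.* N)
      ≈ signedC n (weight (λ _ → 1) ℕ./ N) n * monomial (ζ ^ weight residue) (weight (λ _ → 1) ℕ.% N) A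
    coefficient-prod-w^ n {A} A<N = trans (at (𝕊.*-congˡ prod-w^) (A ℕ.+ n ℕ.* N))
      (binomialPower-⊛-monomial (ζ ^ weight residue) (weight (λ _ → 1)) A<N n)

    -- Dividing `weight (λ _ → 1)` by N gives the integer part of `T` as quotient and N times its
    -- fractional part as remainder. The condition on `frac T` makes this remainder A, and
    -- `signedC-diagonal` accounts for the quotient.
    coefficient-summand : ∀ n {A} → A < N → frac T ≡ + A ℚ./ N →
      sgn n * summand n ≈ (1-z^N 𝕃.^ n ⊛ 𝕃.prod k (λ s → w s 𝕃.^ ms s)) (A ℕ.+ n ℕ.* N)
    coefficient-summand n {A} A<N frac≡ = begin
      sgn n * summand n
        ≡⟨ ≡.cong (λ f → sgn n * (fromℤ R ((ℤ.- ℤ.1ℤ) ℤ.^ ℤ.∣ f ∣)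
             * (fromℕ R (n C ℤ.∣ f ∣) * expζ R ζ N (wsum ns pos a ms)))) floor-wsum-one ⟩
      sgn n * (fromℤ R ((ℤ.- ℤ.1ℤ) ℤ.^ f) * (fromℕ R (n C f) * expζ R ζ N (wsum ns pos a ms)))
        ≈⟨ *-congˡ (*-cong (fromℤ-sgn f) (*-congˡ (trans (^-congʳ ζ (exponent-wsum a)) (ζ^-mod (weight residue))))) ⟩
      sgn n * (sgn f * (fromℕ R (n C f) * ζ ^ weight residue))
        ≈⟨ solve 4 (λ a b c d → a :* (b :* (c :* d)) := (a :* (b :* c)) :* d) refl _ _ _ _ ⟩
      sgn n * (sgn f * fromℕ R (n C f)) * ζ ^ weight residue
        ≈⟨ *-cong (signedC-diagonal n f) (sym (monomial-diagonal _ A)) ⟩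
      signedC n f n * monomial (ζ ^ weight residue) A A
        ≡⟨ ≡.cong (λ B → signedC n f n * monomial (ζ ^ weight residue) B A) W%N≡A ⟨
      signedC n f n * monomial (ζ ^ weight residue) (weight (λ _ → 1) ℕ.% N) A
        ≈⟨ coefficient-prod-w^ n A<N ⟨
      (1-z^N 𝕃.^ n ⊛ 𝕃.prod k (λ s → w s 𝕃.^ ms s)) (A ℕ.+ n ℕ.* N) ∎
      where
      open ≈R
      f = weight (λ _ → 1) ℕ./ N
      W%N≡A : weight (λ _ → 1) ℕ.% N ≡ A
      W%N≡A = /-injective _ _ N (≡.trans (≡.sym frac-wsum-one) frac≡)

    coefficient-vanishes : ∀ n {A} → A < N → ¬ (frac T ≡ + A ℚ./ N) →
      (1-z^N 𝕃.^ n ⊛ 𝕃.prod k (λ s → w s 𝕃.^ ms s)) (A ℕ.+ n ℕ.* N) ≈ 0#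
    coefficient-vanishes n {A} A<N frac≢ = trans (coefficient-prod-w^ n A<N)
      (trans (*-congˡ (monomial-offDiagonal (ζ ^ weight residue) {weight (λ _ → 1) ℕ.% N} {A} λ eq → frac≢ (≡.trans frac-wsum-one (≡.cong (λ B → + B ℚ./ N) eq))))
        (zeroʳ _))

  -- The finite geometric sum is w / (1 - w) times 1 - w^b with b = (n + 1) n_s, and w^b is a
  -- multiple of z^((n + 1) N), because `w s` has exponent N / n_s.
  truncation : ∀ n s i → i < suc n ℕ.* N →
    sumR seriesRing (map (w s 𝕃.^_) (range1 (suc n ℕ.* ns s))) i ≈ (w s ⊛ 1/[1-w] s) i
  truncation n s i i<M = trans (at sum≋ i) (binomial-⊛-< (x ^ b) (w s ⊛ v) (≡.subst (i <_) M≡ i<M))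
    where
    open ≋R
    b = suc n ℕ.* ns s
    d = cofactor ns s
    x = w-coefficient s
    v = 1/[1-w] s
    H = sumR seriesRing (map (w s 𝕃.^_) (range1 b))
    M≡ : suc n ℕ.* N ≡ b ℕ.* d
    M≡ = ≡.trans (≡.cong (suc n ℕ.*_) (≡.trans (≡.sym (cofactor-* ns s)) (ℕP.*-comm d (ns s))))
      (≡.sym (ℕP.*-assoc (suc n) (ns s) d))
    sum≋ : H ≋ binomial (x ^ b) (b ℕ.* d) ⊛ (w s ⊛ v)
    sum≋ = begin
      H                                       ≈⟨ 𝕊.*-identityˡ H ⟨
      𝕊.1# ⊛ H                                ≈⟨ 𝕊.*-congʳ (1-w-inverse s) ⟨
      1-w s ⊛ v ⊛ H                           ≈⟨ 𝕃.solve 3 (λ a b c → a 𝕃.:* b 𝕃.:* c 𝕃.:= (a 𝕃.:* c) 𝕃.:* b)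
                                                   𝕊.refl (1-w s) v H ⟩
      1-w s ⊛ H ⊛ v                           ≈⟨ 𝕊.*-congʳ (𝕊Sums.geometric-sum (w s) b) ⟩
      w s ⊛ (𝕊.1# 𝕊.- w s 𝕃.^ b) ⊛ v          ≈⟨ 𝕊.*-congʳ (𝕊.*-congˡ (𝕊.+-congˡ (𝕊.-‿cong (monomial-^ x d b)))) ⟩
      w s ⊛ binomial (x ^ b) (b ℕ.* d) ⊛ v    ≈⟨ 𝕃.solve 3 (λ a b c → a 𝕃.:* b 𝕃.:* c 𝕃.:= b 𝕃.:* (a 𝕃.:* c))
                                                   𝕊.refl (w s) (binomial (x ^ b) (b ℕ.* d)) v ⟩
      binomial (x ^ b) (b ℕ.* d) ⊛ (w s ⊛ v)  ∎

  -- Coefficients are extracted termwise first, so that the whole sum over tuples becomes one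
  -- series. That series factors over s, and the truncation is then lifted factor by factor.
  S-coefficient : ∀ n {A} → A < N → sgn n * S R a ns pos ζ n (+ A ℚ./ N) ≈ generating n (A ℕ.+ n ℕ.* N)
  S-coefficient n {A} A<N = begin
    sgn n * sumR R (map (λ ms → summand ms n) (filter (λ ms → frac (T ms) ℚP.≟ (+ A ℚ./ N)) Ts))
      ≈⟨ RSums.sumR-*ˡ (sgn n) (λ ms → summand ms n) (filter (λ ms → frac (T ms) ℚP.≟ (+ A ℚ./ N)) Ts) ⟩
    sumR R (map (λ ms → sgn n * summand ms n) (filter (λ ms → frac (T ms) ℚP.≟ (+ A ℚ./ N)) Ts))
      ≈⟨ RSums.sumR-filter (λ ms → frac (T ms) ℚP.≟ (+ A ℚ./ N))
           (λ ms → coefficient-summand ms n A<N) (λ ms → coefficient-vanishes ms n A<N) Ts ⟩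
    sumR R (map (λ ms → (1-z^N 𝕃.^ n ⊛ 𝕃.prod k (λ s → w s 𝕃.^ ms s)) i) Ts)
      ≈⟨ coefficient-sum (1-z^N 𝕃.^ n) (λ ms → 𝕃.prod k (λ s → w s 𝕃.^ ms s)) i Ts ⟩
    (1-z^N 𝕃.^ n ⊛ sumR seriesRing (map (λ ms → 𝕃.prod k (λ s → w s 𝕃.^ ms s)) Ts)) i
      ≈⟨ at (𝕊.*-congˡ (𝕊Sums.sumR-tuples k b w)) i ⟩
    (1-z^N 𝕃.^ n ⊛ 𝕃.prod k (λ s → sumR seriesRing (map (w s 𝕃.^_) (range1 (b s))))) i
      -- The index A + n N lies below (n + 1) N, where truncated and full series still agree.
      ≈⟨ ⊛-cong-at i (λ _ _ → refl) (λ j j≤i → prod-cong-below (suc n ℕ.* N) (truncation n) j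
           (ℕP.≤-<-trans j≤i (index-< n A<N ℕP.≤-refl))) ⟩
    (1-z^N 𝕃.^ n ⊛ 𝕃.prod k (λ s → w s ⊛ 1/[1-w] s)) i
      ≈⟨ at (𝕊.*-congˡ (𝕃.prod-distrib-* k w 1/[1-w])) i ⟩
    (1-z^N 𝕃.^ n ⊛ (𝕃.prod k w ⊛ 𝕃.prod k 1/[1-w])) i
      ≈⟨ at (𝕃.solve 3 (λ a b c → a 𝕃.:* (b 𝕃.:* c) 𝕃.:= b 𝕃.:* (a 𝕃.:* c)) 𝕊.refl
           (1-z^N 𝕃.^ n) (𝕃.prod k w) (𝕃.prod k 1/[1-w])) i ⟩
    generating n i ∎
    where
    open ≈R
    i = A ℕ.+ n ℕ.* N
    b = λ s → suc n ℕ.* ns s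
    Ts = tuples k b

  -- The sum of the m_s / n_s always has the form W / N, so for any other α no tuple survives the
  -- filter.
  S-vanishes : ∀ n α → (∀ A → A < N → α ≢ + A ℚ./ N) → S R a ns pos ζ n α ≈ 0#
  S-vanishes n α α≢ = trans (RSums.sumR-filter (λ ms → frac (T ms) ℚP.≟ α) {g = λ _ → 0#}
      (λ ms frac≡ → contradiction (≡.trans (≡.sym frac≡) (WeightedSums.frac-wsum-one ns pos ms))
        (α≢ _ (ℕDM.m%n<n _ N)))
      (λ _ _ → refl) Ts)
    (RSums.sumR-zero Ts)
    where Ts = tuples k (λ s → suc n ℕ.* ns s)

  generating-suc : ∀ n → generating (suc n) ≋ 1-z^N ⊛ generating n
  generating-suc n = 𝕃.solve 4
    (λ a b c d → a 𝕃.:* ((b 𝕃.:* c) 𝕃.:* d) 𝕃.:= b 𝕃.:* (a 𝕃.:* (c 𝕃.:* d))) 𝕊.refl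
    (𝕃.prod k w) 1-z^N (1-z^N 𝕃.^ n) (𝕃.prod k 1/[1-w])

  1-z^N-power : ∀ n → 1-z^N 𝕃.^ n ≋ 𝕃.prod N (λ y → root (toℕ y) 𝕃.^ n)
  1-z^N-power n = 𝕊.trans (𝕃.^-congˡ n factor-1-z^N) (𝕃.prod-^ {N} (root ∘ toℕ) n)

  generating-roots : ∀ n → generating n ≋
    𝕃.prod k w ⊛ 𝕃.prod N (λ y → root (toℕ y) 𝕃.^ n ⊛ root⁻¹ (toℕ y) 𝕃.^ multiplicity (toℕ y))
  generating-roots n = 𝕊.*-congˡ (𝕊.trans (𝕊.*-cong (1-z^N-power n) prod-1/[1-w])
    (𝕊.sym (𝕃.prod-distrib-* N (λ y → root (toℕ y) 𝕃.^ n) (λ y → root⁻¹ (toℕ y) 𝕃.^ multiplicity (toℕ y)))))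

  sgn≉0 : ∀ n → ¬ (sgn n ≈ 0#)
  sgn≉0 n = ^-nonzero n (-‿nonzero 1≉0)

  -- The degree and leading coefficient are read off from
  -- generating n · ∏ (1 - w s) = ∏ w s · (1 - z^N)^n.
  generating-top : ∀ n → (∀ y → multiplicity y ≤ n) → HasTop (n ℕ.* N) (sgn n * sgn k) (generating n)
  generating-top n c≤n = ≡.subst (λ e → HasTop e (sgn n * sgn k) (generating n)) d≡
    (trans (proj₁ d-top) t≈ , proj₂ d-top)
    where
    factored : 𝕃.prod k w ⊛ 𝕃.prod N (λ y → root (toℕ y) 𝕃.^ (n ℕ.∸ multiplicity (toℕ y))) ≋ generating n
    factored = 𝕊.sym (𝕊.trans (generating-roots n) (𝕊.*-congˡ
      (𝕃.prod-cong N (λ y → 𝕃.^-*-inverse^ (root-inverse (toℕ y)) (c≤n (toℕ y))))))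

    -- Only the existence of a nonzero leading coefficient is taken from this factorisation.
    -- Computing its degree and value here would require the sum of all multiplicities and a product
    -- of powers of ζ.
    nonzero : NonzeroPolynomial
      (𝕃.prod k w ⊛ 𝕃.prod N (λ y → root (toℕ y) 𝕃.^ (n ℕ.∸ multiplicity (toℕ y))))
    nonzero = nonzeroPolynomial-⊛
      (nonzeroPolynomial-prod k (λ s → _ , _ , hasTop-monomial (w-coefficient s) (cofactor ns s)
        , ζ^≉0 (residue s ℕ.* cofactor ns s)))
      (nonzeroPolynomial-prod N (λ y → nonzeroPolynomial-^ (n ℕ.∸ multiplicity (toℕ y))
        (_ , _ , hasTop-binomial (ζ ^ toℕ y) (s≤s z≤n) , -‿nonzero (ζ^≉0 (toℕ y)))))

    d = proj₁ nonzero
    t = proj₁ (proj₂ nonzero)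
    D = sumℕ (cofactor ns)
    u = prod k w-coefficient

    d-top : HasTop d t (generating n)
    d-top = hasTop-cong factored (proj₁ (proj₂ (proj₂ nonzero)))

    t≉0 : ¬ (t ≈ 0#)
    t≉0 = proj₂ (proj₂ (proj₂ nonzero))

    u≉0 : ¬ (u ≈ 0#)
    u≉0 = prod-nonzero k w-coefficient (λ s → ζ^≉0 (residue s ℕ.* cofactor ns s))

    cleared : generating n ⊛ 𝕃.prod k 1-w ≋ 𝕃.prod k w ⊛ 1-z^N 𝕃.^ n
    cleared = begin
      𝕃.prod k w ⊛ (1-z^N 𝕃.^ n ⊛ 𝕃.prod k 1/[1-w]) ⊛ 𝕃.prod k 1-w
        ≈⟨ 𝕃.solve 4 (λ a b c d → a 𝕃.:* (b 𝕃.:* c) 𝕃.:* d 𝕃.:= a 𝕃.:* b 𝕃.:* (d 𝕃.:* c)) 𝕊.refl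
             (𝕃.prod k w) (1-z^N 𝕃.^ n) (𝕃.prod k 1/[1-w]) (𝕃.prod k 1-w) ⟩
      𝕃.prod k w ⊛ 1-z^N 𝕃.^ n ⊛ (𝕃.prod k 1-w ⊛ 𝕃.prod k 1/[1-w])
        ≈⟨ 𝕊.*-congˡ (𝕊.trans (𝕊.sym (𝕃.prod-distrib-* k 1-w 1/[1-w])) (𝕃.prod-trivial k 1-w-inverse)) ⟩
      𝕃.prod k w ⊛ 1-z^N 𝕃.^ n ⊛ 𝕊.1#
        ≈⟨ 𝕊.*-identityʳ (𝕃.prod k w ⊛ 1-z^N 𝕃.^ n) ⟩
      𝕃.prod k w ⊛ 1-z^N 𝕃.^ n ∎
      where open ≋R

    unique : d ℕ.+ D ≡ D ℕ.+ n ℕ.* N × t * prod k (λ s → - w-coefficient s) ≈ u * sgn n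
    unique = hasTop-unique
      (hasTop-⊛ d-top (hasTop-prod (cofactor ns) (λ s → - w-coefficient s)
        (λ s → hasTop-binomial (w-coefficient s) (cofactor>0 s))))
      (hasTop-cong (𝕊.sym cleared) (hasTop-⊛
        (hasTop-prod (cofactor ns) w-coefficient (λ s → hasTop-monomial (w-coefficient s) (cofactor ns s)))
        (hasTop-^ n (hasTop-binomial 1# (ℕ.>-nonZero⁻¹ N)))))
      (*-nonzero t≉0 (prod-nonzero k _ (λ s → -‿nonzero (ζ^≉0 (residue s ℕ.* cofactor ns s)))))
      (*-nonzero u≉0 (sgn≉0 n))

    d≡ : d ≡ n ℕ.* N
    d≡ = ℕP.+-cancelˡ-≡ D d (n ℕ.* N) (≡.trans (ℕP.+-comm D d) (proj₁ unique))

    -- One factor of the inserted square of `sgn k` turns `u` into the product of the negated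
    -- coefficients, which is the leading coefficient of the product of the `1-w s`.
    t≈ : t ≈ sgn n * sgn k
    t≈ = *-cancelˡ-nonzero u≉0 (begin
      u * t                       ≈⟨ *-identityʳ _ ⟨
      u * t * 1#                  ≈⟨ *-congˡ (sgn-square k) ⟨
      u * t * (sgn k * sgn k)     ≈⟨ solve 3 (λ u t s → u :* t :* (s :* s) := t :* (s :* u) :* s) refl u t (sgn k) ⟩
      t * (sgn k * u) * sgn k     ≈⟨ *-congʳ (*-congˡ (prod-neg k w-coefficient)) ⟨
      t * prod k (λ s → - w-coefficient s) * sgn k  ≈⟨ *-congʳ (proj₂ unique) ⟩
      u * sgn n * sgn k           ≈⟨ *-assoc _ _ _ ⟩
      u * (sgn n * sgn k)         ∎)
      where open ≈R

  -- Prescribed coefficients, polynomiality and bounded multiplicity.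

  Prescribed : ℕ → Set ℓ
  Prescribed n = ∀ A → A < N → (A ≡ 0 → generating n (A ℕ.+ n ℕ.* N) ≈ sgn n * sgn k)
                             × (A ≢ 0 → generating n (A ℕ.+ n ℕ.* N) ≈ 0#)

  -- By `generating-top` the index A + n N is the top one for A = 0 and exceeds the degree bound for
  -- A > 0.
  bounded⇒prescribed : ∀ n → (∀ y → multiplicity y ≤ n) → Prescribed n
  bounded⇒prescribed n c≤n A A<N =
    (λ { ≡.refl → proj₁ top }) , λ A≢0 → proj₂ top (A ℕ.+ n ℕ.* N) (ℕP.+-monoˡ-≤ (n ℕ.* N) (ℕP.n≢0⇒n>0 A≢0))
    where top = generating-top n c≤n

  generating-section : ∀ n {A} → A < N → ∀ j →
    generating n (A ℕ.+ suc j ℕ.* N) ≈ generating (suc n) (A ℕ.+ suc j ℕ.* N) + generating n (A ℕ.+ j ℕ.* N)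
  generating-section n {A} A<N j = sym (begin
    generating (suc n) (A ℕ.+ suc j ℕ.* N) + y
      ≈⟨ +-congʳ (trans (at (generating-suc n) (A ℕ.+ suc j ℕ.* N)) (binomial-section-suc (generating n) A<N j)) ⟩
    x - y + y       ≈⟨ +-assoc x (- y) y ⟩
    x + (- y + y)   ≈⟨ trans (+-congˡ (-‿inverseˡ y)) (+-identityʳ x) ⟩
    x               ∎)
    where
    open ≈R
    x = generating n (A ℕ.+ suc j ℕ.* N)
    y = generating n (A ℕ.+ j ℕ.* N)

  module _ (m : ℕ) (prescribed : ∀ n → m ≤ n → Prescribed n) where

    -- Call the indices A + j N with 0 ≤ A < N row j. From G_n = G_(n+1) + z^N G_n, an entry of G_n
    -- that is t + 1 rows beyond row n is the sum of an entry of G_(n+1) that is t rows beyond row n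
    -- + 1 and an entry of G_n that is t rows beyond row n. By induction on t both vanish, except
    -- when t = 0 and A = 0: then they are prescribed values of opposite sign and cancel.
    generating-vanishes : ∀ t n A → m ≤ n → A < N → (A ≡ 0 → t ≢ 0) →
      generating n (A ℕ.+ (t ℕ.+ n) ℕ.* N) ≈ 0#
    generating-vanishes zero n A m≤n A<N A≢0 =
      proj₂ (prescribed n m≤n A A<N) (λ A≡0 → A≢0 A≡0 ≡.refl)
    generating-vanishes (suc t) n A m≤n A<N _ =
      trans (generating-section n A<N (t ℕ.+ n)) (cancel (t ℕP.≟ 0) (A ℕP.≟ 0))
      where
      open ≈R
      m≤1+n = ℕP.m≤n⇒m≤1+n m≤n
      both-zero : (A ≡ 0 → t ≢ 0) →
        generating (suc n) (A ℕ.+ suc (t ℕ.+ n) ℕ.* N) + generating n (A ℕ.+ (t ℕ.+ n) ℕ.* N) ≈ 0#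
      both-zero nondegenerate = trans (+-cong
        (≡.subst (λ j → generating (suc n) (A ℕ.+ j ℕ.* N) ≈ 0#) (ℕP.+-suc t n)
          (generating-vanishes t (suc n) A m≤1+n A<N nondegenerate))
        (generating-vanishes t n A m≤n A<N nondegenerate)) (+-identityˡ 0#)
      cancel : Dec (t ≡ 0) → Dec (A ≡ 0) →
        generating (suc n) (A ℕ.+ suc (t ℕ.+ n) ℕ.* N) + generating n (A ℕ.+ (t ℕ.+ n) ℕ.* N) ≈ 0#
      cancel (no t≢0)     _         = both-zero (λ _ → t≢0)
      cancel (yes _)      (no A≢0)  = both-zero (λ A≡0 → contradiction A≡0 A≢0)
      cancel (yes ≡.refl) (yes A≡0) = begin
        generating (suc n) (A ℕ.+ suc n ℕ.* N) + generating n (A ℕ.+ n ℕ.* N)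
          ≈⟨ +-cong (proj₁ (prescribed (suc n) m≤1+n A A<N) A≡0) (proj₁ (prescribed n m≤n A A<N) A≡0) ⟩
        sgn (suc n) * sgn k + sgn n * sgn k  ≈⟨ distribʳ _ _ _ ⟨
        (sgn (suc n) + sgn n) * sgn k        ≈⟨ *-congʳ (trans (+-congʳ (sgn-suc n)) (-‿inverseˡ _)) ⟩
        0# * sgn k                           ≈⟨ zeroˡ _ ⟩
        0#                                   ∎

    generating-polynomial : Polynomial (generating m)
    generating-polynomial = suc m ℕ.* N , λ i le →
      let m<i/N : m < i ℕ./ N
          m<i/N = ≡.subst (_≤ i ℕ./ N) (ℕDM.m*n/n≡m (suc m) N) (ℕDM./-monoˡ-≤ N le)
          -- The index `i` lies `suc t` rows beyond row m; being positive, this offset avoids the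
          -- exceptional entry with A = 0 in row m itself.
          t = i ℕ./ N ℕ.∸ suc m
          i≡ : i ℕ.% N ℕ.+ (suc t ℕ.+ m) ℕ.* N ≡ i
          i≡ = ≡.trans (≡.cong (λ q → i ℕ.% N ℕ.+ q ℕ.* N)
                 (≡.trans (≡.sym (ℕP.+-suc t m)) (ℕP.m∸n+n≡m m<i/N)))
                 (≡.sym (ℕDM.m≡m%n+[m/n]*n i N))
      in ≡.subst (λ j → generating m j ≈ 0#) i≡
           (generating-vanishes (suc t) m (i ℕ.% N) ℕP.≤-refl (ℕDM.m%n<n i N) (λ _ ()))

  -- If the multiplicity of y₀ exceeded m, then multiplying by suitable linear factors would leave
  -- a polynomial with denominator root y₀, whose numerator is prime to root y₀.
  polynomial⇒bounded : ∀ m → Polynomial (generating m) → ∀ y → multiplicity (toℕ {N} y) ≤ m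
  polynomial⇒bounded m poly y₀ with multiplicity (toℕ y₀) ℕP.≤? m
  ... | yes c≤m = c≤m
  ... | no  c≰m = contradiction (polynomial-cong cofactored (polynomial-⊛ poly complement-polynomial))
    (removable-not-divisible (ζ^≉0 (toℕ y₀)) numerator-removable)
    where
    open Removal (ζ ^ toℕ y₀)
    open ≋R
    multiplicityAt = λ (y : Fin N) → multiplicity (toℕ y)
    m<c = ℕP.≰⇒> c≰m
    -- The exponents are chosen so that `complement` cancels the whole denominator at y ≠ y₀,
    -- leaving root^m, and all but one factor of it at y₀. There root^m already cancels m of the c
    -- factors, so c - (m + 1) more are supplied; this is a genuine difference since m < c.
    complement denominator numerator : Fin N → Series
    complement  y = if does (y FinP.≟ y₀) then root (toℕ y) 𝕃.^ (multiplicityAt y ℕ.∸ suc m)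
                                          else root (toℕ y) 𝕃.^ multiplicityAt y
    denominator y = if does (y FinP.≟ y₀) then root⁻¹ (toℕ y) else 𝕊.1#
    numerator   y = if does (y FinP.≟ y₀) then 𝕊.1# else root (toℕ y) 𝕃.^ m

    complement-polynomial : Polynomial (𝕃.prod N complement)
    complement-polynomial = polynomial-prod N λ y → go y (does (y FinP.≟ y₀))
      where
      go : ∀ (y : Fin N) b → Polynomial (if b then root (toℕ y) 𝕃.^ (multiplicityAt y ℕ.∸ suc m)
                                             else root (toℕ y) 𝕃.^ multiplicityAt y)
      go y true  = polynomial-^ (multiplicityAt y ℕ.∸ suc m) (polynomial-linear (ζ ^ toℕ y))
      go y false = polynomial-^ (multiplicityAt y) (polynomial-linear (ζ ^ toℕ y))

    numerator-removable : Removable (𝕃.prod k w ⊛ 𝕃.prod N numerator)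
    numerator-removable = removable-⊛
      (removable-prod k (λ s → removable-monomial (cofactor ns s) (ζ^≉0 (residue s ℕ.* cofactor ns s))))
      (removable-prod N go)
      where
      go : ∀ y → Removable (numerator y)
      go y with y FinP.≟ y₀
      ... | yes _    = removable-1
      ... | no  y≢y₀ = removable-^ m (removable-linear
        (ζ^-distinct (FinP.toℕ<n y) (FinP.toℕ<n y₀) (y≢y₀ ∘ FinP.toℕ-injective)))

    denominator-prod : 𝕃.prod N denominator ≋ root⁻¹ (toℕ y₀)
    denominator-prod = 𝕊.trans (𝕃.prod-single y₀ denominator other) at-y₀
      where
      other : ∀ y → y ≢ y₀ → denominator y ≋ 𝕊.1#
      other y y≢y₀ with y FinP.≟ y₀
      ... | yes y≡y₀ = contradiction y≡y₀ y≢y₀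
      ... | no  _    = 𝕊.refl
      at-y₀ : denominator y₀ ≋ root⁻¹ (toℕ y₀)
      at-y₀ with y₀ FinP.≟ y₀
      ... | yes _     = 𝕊.refl
      ... | no  y₀≢y₀ = contradiction ≡.refl y₀≢y₀

    pointwise : ∀ y → root (toℕ y) 𝕃.^ m ⊛ root⁻¹ (toℕ y) 𝕃.^ multiplicityAt y ⊛ complement y
      ≋ denominator y ⊛ numerator y
    pointwise y with y FinP.≟ y₀
    ... | no _ = begin
      x 𝕃.^ m ⊛ x⁻¹ 𝕃.^ μ ⊛ x 𝕃.^ μ
        ≈⟨ 𝕃.solve 3 (λ a b c → a 𝕃.:* b 𝕃.:* c 𝕃.:= (c 𝕃.:* b) 𝕃.:* a) 𝕊.refl (x 𝕃.^ m) (x⁻¹ 𝕃.^ μ) (x 𝕃.^ μ) ⟩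
      x 𝕃.^ μ ⊛ x⁻¹ 𝕃.^ μ ⊛ x 𝕃.^ m  ≈⟨ 𝕊.*-congʳ (𝕃.inverse-^ (root-inverse (toℕ y)) μ) ⟩
      𝕊.1# ⊛ x 𝕃.^ m                 ∎
      where
      x = root (toℕ y)
      x⁻¹ = root⁻¹ (toℕ y)
      μ = multiplicityAt y
    -- The multiplicity is 1 + (m + e): one factor x⁻¹ is split off, and the other m + e cancel
    -- against x^m and x^e.
    ... | yes ≡.refl = begin
      x 𝕃.^ m ⊛ x⁻¹ 𝕃.^ μ ⊛ x 𝕃.^ e
        ≈⟨ 𝕊.*-congʳ (𝕊.*-congˡ (𝕃.^-congʳ x⁻¹ (≡.sym (ℕP.m+[n∸m]≡n m<c)))) ⟩
      x 𝕃.^ m ⊛ (x⁻¹ ⊛ x⁻¹ 𝕃.^ (m ℕ.+ e)) ⊛ x 𝕃.^ e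
        ≈⟨ 𝕃.solve 4 (λ a b c d → a 𝕃.:* (b 𝕃.:* c) 𝕃.:* d 𝕃.:= b 𝕃.:* ((a 𝕃.:* d) 𝕃.:* c)) 𝕊.refl
             (x 𝕃.^ m) x⁻¹ (x⁻¹ 𝕃.^ (m ℕ.+ e)) (x 𝕃.^ e) ⟩
      x⁻¹ ⊛ (x 𝕃.^ m ⊛ x 𝕃.^ e ⊛ x⁻¹ 𝕃.^ (m ℕ.+ e))
        ≈⟨ 𝕊.*-congˡ (𝕊.*-congʳ (𝕃.^-+ x m e)) ⟨
      x⁻¹ ⊛ (x 𝕃.^ (m ℕ.+ e) ⊛ x⁻¹ 𝕃.^ (m ℕ.+ e))
        ≈⟨ 𝕊.*-congˡ (𝕃.inverse-^ (root-inverse (toℕ y)) (m ℕ.+ e)) ⟩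
      x⁻¹ ⊛ 𝕊.1# ∎
      where
      x = root (toℕ y)
      x⁻¹ = root⁻¹ (toℕ y)
      μ = multiplicityAt y
      e = μ ℕ.∸ suc m

    cofactored : generating m ⊛ 𝕃.prod N complement
      ≋ root⁻¹ (toℕ y₀) ⊛ (𝕃.prod k w ⊛ 𝕃.prod N numerator)
    cofactored = begin
      generating m ⊛ 𝕃.prod N complement
        ≈⟨ 𝕊.*-congʳ (generating-roots m) ⟩
      𝕃.prod k w ⊛ 𝕃.prod N fraction ⊛ 𝕃.prod N complement
        ≈⟨ 𝕊.*-assoc (𝕃.prod k w) (𝕃.prod N fraction) (𝕃.prod N complement) ⟩
      𝕃.prod k w ⊛ (𝕃.prod N fraction ⊛ 𝕃.prod N complement)
        ≈⟨ 𝕊.*-congˡ (𝕃.prod-distrib-* N fraction complement) ⟨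
      𝕃.prod k w ⊛ 𝕃.prod N (λ y → fraction y ⊛ complement y)
        ≈⟨ 𝕊.*-congˡ (𝕃.prod-cong N pointwise) ⟩
      𝕃.prod k w ⊛ 𝕃.prod N (λ y → denominator y ⊛ numerator y)
        ≈⟨ 𝕊.*-congˡ (𝕃.prod-distrib-* N denominator numerator) ⟩
      𝕃.prod k w ⊛ (𝕃.prod N denominator ⊛ 𝕃.prod N numerator)
        ≈⟨ 𝕊.*-congˡ (𝕊.*-congʳ denominator-prod) ⟩
      𝕃.prod k w ⊛ (root⁻¹ (toℕ y₀) ⊛ 𝕃.prod N numerator)
        ≈⟨ 𝕃.solve 3 (λ a b c → a 𝕃.:* (b 𝕃.:* c) 𝕃.:= b 𝕃.:* (a 𝕃.:* c)) 𝕊.refl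
             (𝕃.prod k w) (root⁻¹ (toℕ y₀)) (𝕃.prod N numerator) ⟩
      root⁻¹ (toℕ y₀) ⊛ (𝕃.prod k w ⊛ 𝕃.prod N numerator) ∎
      where
      fraction : Fin N → Series
      fraction y = root (toℕ y) 𝕃.^ m ⊛ root⁻¹ (toℕ y) 𝕃.^ multiplicityAt y

  -- The equivalence for the sums themselves.

  SumCondition : ℕ → Set ℓ
  SumCondition n = ∀ (α : ℚ) → 0ℚ ℚ.≤ α → α ℚ.< 1ℚ →
    (α ≡ 0ℚ → S R a ns pos ζ n α ≈ fromℤ R ((ℤ.- ℤ.1ℤ) ℤ.^ k)) × (α ≢ 0ℚ → S R a ns pos ζ n α ≈ 0#)

  0/N≡0 : + 0 ℚ./ N ≡ 0ℚ
  0/N≡0 = /-≡ (+ 0) N (+ 0) 1 ≡.refl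

  sgn-cancel : ∀ n {x y} → sgn n * x ≈ sgn n * y → x ≈ y
  sgn-cancel n = *-cancelˡ-nonzero (sgn≉0 n)

  -- Only the N values A / N can give a nonempty sum. Whether α is one of them is decided by a
  -- finite search; 0 is always among them, so in the negative case α = 0 is absurd and `S-vanishes`
  -- gives the rest.
  prescribed⇒sumCondition : ∀ n → Prescribed n → SumCondition n
  prescribed⇒sumCondition n prescribed α _ _ with FinP.any? (λ (A : Fin N) → α ℚP.≟ (+ toℕ A ℚ./ N))
  ... | yes (A , ≡.refl) =
      (λ A/N≡0 → sgn-cancel n (trans (S-coefficient n A<N) (trans
        (proj₁ (prescribed (toℕ A) A<N) (/-injective (toℕ A) 0 N (≡.trans A/N≡0 (≡.sym 0/N≡0))))
        (*-congˡ (sym (fromℤ-sgn k))))))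
    , (λ A/N≢0 → sgn-cancel n (trans (S-coefficient n A<N) (trans
        (proj₂ (prescribed (toℕ A) A<N) (λ A≡0 → A/N≢0 (≡.trans (≡.cong (λ A → + A ℚ./ N) A≡0) 0/N≡0)))
        (sym (zeroʳ _)))))
    where A<N = FinP.toℕ<n A
  ... | no α≢ =
      (λ α≡0 → contradiction (≡.trans α≡0 (≡.sym 0/N≡0)) (α≢′ 0 (ℕ.>-nonZero⁻¹ N)))
    , (λ _ → S-vanishes n α α≢′)
    where
    α≢′ : ∀ A → A < N → α ≢ + A ℚ./ N
    α≢′ A A<N α≡ = α≢ (fromℕ< A<N , ≡.trans α≡ (≡.cong (λ A → + A ℚ./ N) (≡.sym (FinP.toℕ-fromℕ< A<N))))

  sumCondition⇒prescribed : ∀ n → SumCondition n → Prescribed n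
  sumCondition⇒prescribed n condition A A<N =
      (λ A≡0 → trans (sym (S-coefficient n A<N)) (*-congˡ (trans
        (proj₁ (condition (+ A ℚ./ N) (0≤/ A N) (/<1 N A<N)) (≡.trans (≡.cong (λ A → + A ℚ./ N) A≡0) 0/N≡0))
        (fromℤ-sgn k))))
    , (λ A≢0 → trans (sym (S-coefficient n A<N)) (trans (*-congˡ
        (proj₂ (condition (+ A ℚ./ N) (0≤/ A N) (/<1 N A<N))
          (λ A/N≡0 → A≢0 (/-injective A 0 N (≡.trans A/N≡0 (≡.sym 0/N≡0))))))
        (zeroʳ _)))

  isMSystem⇔sumCondition : ∀ m → IsMSystem m a ns ⇔ (∀ n → m ≤ n → n < k → SumCondition n)
  isMSystem⇔sumCondition m = mk⇔ to from
    where
    to : IsMSystem m a ns → ∀ n → m ≤ n → n < k → SumCondition n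
    to mSystem n m≤n _ =
      prescribed⇒sumCondition n (bounded⇒prescribed n (λ y → ℕP.≤-trans (mSystem (+ y)) m≤n))

    from : (∀ n → m ≤ n → n < k → SumCondition n) → IsMSystem m a ns
    from condition x = ≡.subst (_≤ m) (≡.sym count≡) (polynomial⇒bounded m
      (generating-polynomial m prescribed) (fromℕ< y<N))
      where
      y<N : x %ℕ N < N
      y<N = n%ℕd<d x N
      count≡ : coverCount a ns x ≡ multiplicity (toℕ (fromℕ< y<N))
      count≡ = ≡.trans (coverCount-%ℕ a ns x) (≡.cong multiplicity (≡.sym (FinP.toℕ-fromℕ< y<N)))
      prescribed : ∀ n → m ≤ n → Prescribed n
      prescribed n m≤n with n ℕP.<? k
      ... | yes n<k = sumCondition⇒prescribed n (condition n m≤n n<k)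
      ... | no  n≮k = bounded⇒prescribed n (λ y → ℕP.≤-trans (coverCount≤k a ns (+ y)) (ℕP.≮⇒≥ n≮k))

theorem1p3 : ∀ {c ℓ : Level} (m k : ℕ) → 1 ≤ m → 1 ≤ k →
    (a : Fin k → ℤ) (ns : Fin k → ℕ) (pos : ∀ s → NonZero (ns s)) →
    (R : CommutativeRing c ℓ) → IsDomain R → CharZero R →
    (ζ : CommutativeRing.Carrier R) → IsPrimitiveRoot R ζ (prodℕ ns) →
    IsMSystem m a ns
    ⇔ (∀ (n : ℕ) → m ≤ n → n < k → ∀ (α : ℚ) → 0ℚ ℚ.≤ α → α ℚ.< 1ℚ →
    (α ≡ 0ℚ → CommutativeRing._≈_ R (S R a ns pos ζ n α) (fromℤ R ((ℤ.- ℤ.1ℤ) ℤ.^ k)))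
    × (α ≢ 0ℚ → CommutativeRing._≈_ R (S R a ns pos ζ n α) (CommutativeRing.0# R)))
theorem1p3 m k _ _ a ns pos R dom _ ζ primitive-ζ = isMSystem⇔sumCondition m
  where open Covering R dom a ns pos ζ primitive-ζ
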